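{- Let $t=2m'+1\ge3$ be odd, $r\ge2$, $R'=m'+r$, $\Lambda=(\Lambda_1\ge\dots\ge\Lambda_{R'}\ge0)$ integers, $X\in\mathbb Z^r$, and let $M=M(\Lambda,X)$ be the $R'\times R'$ matrix defined in the context, with $V_i=2\Lambda_i+2(R'-i)+1$. For each row $i$ let $c_i\in\{0,1,\dots,m'\}$ and $\sigma_i\in\{\pm1\}$ be the unique pair with $\sigma_iV_i\equiv c_i\pmod t$ (with $\sigma_i=+1$ when $c_i=0$), and set $w_i=\sigma_iV_i$. For each column $j$ set $\tau_j=+1$ if $j$ is frozen, and otherwise let $b_j\in\{0,\dots,m'\}$ and $\tau_j\in\{\pm1\}$ be the unique pair with $X_j\equiv\tau_jb_j\pmod t$, with $\tau_j=+1$ when $b_j=0$. Let $\pi$ order the rows by $(c_i,w_i)$ increasing lexicographically. Then $$\widehat M_{\pi(i),j}:=\sigma_i\,\tau_j\,M_{i,j}$$ is a $0/1$ matrix whose ones are consecutive in every column. Consequently $M$ is totally unimodular.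
   Context: Folding: the folded class of an integer $a$ is the unique $c\in\{0,\dots,m'\}$ with $a\equiv\pm c\pmod t$; its folding sign is $+1$ if $a\equiv c\pmod t$ and $-1$ otherwise. $M(\Lambda,X)$: rows indexed by $i=1,\dots,R'$; columns are $m'$ frozen slots followed by $r$ free slots. For $1\le p\le m'$ the $p$-th frozen column has in row $i$ the folding sign of $V_i$ if $V_i$ has folded class $m'-p+1$, and $0$ otherwise. For a free slot attached to the coordinate $X_j$ of $X$ ($1\le j\le r$), the entry in row $i$ is the sum of those $\varepsilon\in\{\pm1\}$ with $\varepsilon V_i=X_j+tk$ for some odd integer $k\ge1$ ($0$ if there is none). A matrix is totally unimodular if every square submatrix has determinant in $\{0,\pm1\}$. -}

module Defs where

open import Algebra.Properties.CommutativeMonoid.Sum using (sum)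
open import Data.Bool using (if_then_else_)
open import Data.Fin as Fin using (Fin; zero; suc; toℕ; fromℕ<; punchIn; splitAt)
open import Data.Fin.Permutation using (Permutation′; _⟨$⟩ʳ_; _⟨$⟩ˡ_)
open import Data.Fin.Properties using (toℕ-fromℕ<; toℕ-injective; toℕ≤pred[n])
open import Data.Integer
  using (ℤ; +_; -_; _+_; _-_; _*_; _^_; _/ℕ_; _%ℕ_; _≤_; _<_; _◃_; 0ℤ; 1ℤ; -1ℤ)
open import Data.Integer.Divisibility.Signed
  using (_∣_; divides; _∣?_; ∣⇒∣ᵤ; ∣m∣n⇒∣m-n; ∣m∣n⇒∣m+n; ∣m⇒∣-m)
open import Data.Integer.DivMod using (a≡a%ℕn+[a/ℕn]*n; n%ℕd<d)
open import Data.Integer.Properties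
  using (+-0-commutativeMonoid; +-injective; *-cancelˡ-≡; _≤?_; i-j≡0⇒i≡j; ∣i∣≡0⇒i≡0;
         ∣i-j∣≤∣i∣+∣j∣; ⊖-≥; m-n≡m⊖n)
open import Data.Integer.Tactic.RingSolver using (solve-∀)
open import Data.List using ([]; _∷_; filter; foldr; map)
open import Data.Nat as ℕ using (ℕ; zero; suc; _∸_)
import Data.Nat.Divisibility as ℕᵈ
import Data.Nat.Properties as ℕᵖ
open import Data.Product using (∃; ∃!; ∃-syntax; _×_; _,_; proj₁; proj₂)
open import Data.Product.Relation.Binary.Lex.Strict using (×-Lex)
open import Data.Sign using (Sign)
open import Data.Sum using (_⊎_; inj₁; inj₂; [_,_]′)
open import Relation.Binary.PropositionalEquality
  using (_≡_; refl; sym; trans; cong; cong₂; subst; module ≡-Reasoning)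
open import Relation.Nullary using (¬_; Dec; yes; no; does; contradiction)
open import Relation.Nullary.Decidable using (¬?; _×-dec_; map′)

t : ℕ → ℕ
t m = suc (2 ℕ.* m)

⟦_⟧ : Sign → ℤ
⟦ s ⟧ = s ◃ 1

infix 4 _≅_[mod_]

_≅_[mod_] : ℤ → ℤ → ℕ → Set
a ≅ b [mod n ] = + n ∣ a - b

-- Folding modulo t m = 2m + 1; elements of Fin (suc m) stand for the residues 0, …, m.

IsFoldedClass : (m : ℕ) → ℤ → Fin (suc m) → Set
IsFoldedClass m a c = a ≅ + toℕ c [mod t m ] ⊎ a ≅ - + toℕ c [mod t m ]

IsRowPair : (m : ℕ) → ℤ → Fin (suc m) × Sign → Set
IsRowPair m v (c , σ) = ⟦ σ ⟧ * v ≅ + toℕ c [mod t m ] × (c ≡ zero → σ ≡ Sign.+)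

IsColumnPair : (m : ℕ) → ℤ → Fin (suc m) × Sign → Set
IsColumnPair m x (b , τ) = x ≅ ⟦ τ ⟧ * + toℕ b [mod t m ] × (b ≡ zero → τ ≡ Sign.+)

private

  small : ∀ m (c : Fin (suc m)) → toℕ c ℕ.≤ m
  small m = toℕ≤pred[n]

  bound : ∀ m (c d : Fin (suc m)) → toℕ c ℕ.+ toℕ d ℕ.< t m
  bound m c d = ℕ.s≤s (subst (λ k → toℕ c ℕ.+ toℕ d ℕ.≤ m ℕ.+ k) (sym (ℕᵖ.+-identityʳ m))
                         (ℕᵖ.+-mono-≤ (small m c) (small m d)))

  multiple<⇒≡0 : ∀ {n k} → n ℕᵈ.∣ k → k ℕ.< n → k ≡ 0
  multiple<⇒≡0 {k = zero}  n∣k k<n = refl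
  multiple<⇒≡0 {k = suc k} n∣k k<n = contradiction (ℕᵈ.∣⇒≤ n∣k) (ℕᵖ.<⇒≱ k<n)

  diff⇒≡ : ∀ m (c d : Fin (suc m)) → + t m ∣ + toℕ c - + toℕ d → c ≡ d
  diff⇒≡ m c d h = toℕ-injective (+-injective (i-j≡0⇒i≡j (+ toℕ c) (+ toℕ d) (∣i∣≡0⇒i≡0
    (multiple<⇒≡0 (∣⇒∣ᵤ h)
      (ℕᵖ.≤-<-trans (∣i-j∣≤∣i∣+∣j∣ (+ toℕ c) (+ toℕ d)) (bound m c d))))))

  sum⇒≡0 : ∀ m (c d : Fin (suc m)) → + t m ∣ + toℕ c + + toℕ d → c ≡ zero × d ≡ zero
  sum⇒≡0 m c d h = toℕ-injective (ℕᵖ.m+n≡0⇒m≡0 (toℕ c) eq)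
                 , toℕ-injective (ℕᵖ.m+n≡0⇒n≡0 (toℕ c) eq)
    where
    eq : toℕ c ℕ.+ toℕ d ≡ 0
    eq = multiple<⇒≡0 (∣⇒∣ᵤ h) (bound m c d)

  ∣-cong : ∀ {n a b} → a ≡ b → n ∣ a → n ∣ b
  ∣-cong refl h = h

  class-≡ : ∀ m {a} {c d : Fin (suc m)} → IsFoldedClass m a c → IsFoldedClass m a d → c ≡ d
  class-≡ m {a} {c} {d} (inj₁ p) (inj₁ q) = diff⇒≡ m c d
    (∣-cong (lem a (+ toℕ c) (+ toℕ d)) (∣m∣n⇒∣m-n q p))
    where lem : ∀ a x y → (a - y) - (a - x) ≡ x - y
          lem = solve-∀
  class-≡ m {a} {c} {d} (inj₁ p) (inj₂ q) =
    let c≡0 , d≡0 = sum⇒≡0 m c d (∣-cong (lem a (+ toℕ c) (+ toℕ d)) (∣m∣n⇒∣m-n q p))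
    in trans c≡0 (sym d≡0)
    where lem : ∀ a x y → (a - - y) - (a - x) ≡ x + y
          lem = solve-∀
  class-≡ m {a} {c} {d} (inj₂ p) (inj₁ q) =
    let c≡0 , d≡0 = sum⇒≡0 m c d (∣-cong (lem a (+ toℕ c) (+ toℕ d)) (∣m∣n⇒∣m-n p q))
    in trans c≡0 (sym d≡0)
    where lem : ∀ a x y → (a - - x) - (a - y) ≡ x + y
          lem = solve-∀
  class-≡ m {a} {c} {d} (inj₂ p) (inj₂ q) = diff⇒≡ m c d
    (∣-cong (lem a (+ toℕ c) (+ toℕ d)) (∣m∣n⇒∣m-n p q))
    where lem : ∀ a x y → (a - - x) - (a - - y) ≡ x - y
          lem = solve-∀

  row⇒class : ∀ m {v c σ} → IsRowPair m v (c , σ) → IsFoldedClass m v c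
  row⇒class m {v} {c} {Sign.+} (h , _) = inj₁ (∣-cong (lem v (+ toℕ c)) h)
    where lem : ∀ a x → 1ℤ * a - x ≡ a - x
          lem = solve-∀
  row⇒class m {v} {c} {Sign.-} (h , _) = inj₂ (∣-cong (lem v (+ toℕ c)) (∣m⇒∣-m h))
    where lem : ∀ a x → - (-1ℤ * a - x) ≡ a - - x
          lem = solve-∀

  row⇒column : ∀ m {v p} → IsRowPair m v p → IsColumnPair m v p
  row⇒column m {v} {c , Sign.+} (h , z) = ∣-cong (lem v (+ toℕ c)) h , z
    where lem : ∀ a x → 1ℤ * a - x ≡ a - 1ℤ * x
          lem = solve-∀
  row⇒column m {v} {c , Sign.-} (h , z) = ∣-cong (lem v (+ toℕ c)) (∣m⇒∣-m h) , z
    where lem : ∀ a x → - (-1ℤ * a - x) ≡ a - -1ℤ * x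
          lem = solve-∀

  column⇒row : ∀ m {v p} → IsColumnPair m v p → IsRowPair m v p
  column⇒row m {v} {c , Sign.+} (h , z) = ∣-cong (lem v (+ toℕ c)) h , z
    where lem : ∀ a x → a - 1ℤ * x ≡ 1ℤ * a - x
          lem = solve-∀
  column⇒row m {v} {c , Sign.-} (h , z) = ∣-cong (lem v (+ toℕ c)) (∣m⇒∣-m h) , z
    where lem : ∀ a x → - (a - -1ℤ * x) ≡ -1ℤ * a - x
          lem = solve-∀

  opp⇒zero : ∀ m {v} (c : Fin (suc m)) →
             ⟦ Sign.+ ⟧ * v ≅ + toℕ c [mod t m ] → ⟦ Sign.- ⟧ * v ≅ + toℕ c [mod t m ] → c ≡ zero
  opp⇒zero m {v} c p q = proj₁ (sum⇒≡0 m c c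
    (∣-cong (lem v (+ toℕ c)) (∣m⇒∣-m (∣m∣n⇒∣m+n p q))))
    where lem : ∀ a x → - ((1ℤ * a - x) + (-1ℤ * a - x)) ≡ x + x
          lem = solve-∀

  sign-≡ : ∀ m {v c} σ σ′ → IsRowPair m v (c , σ) → IsRowPair m v (c , σ′) → σ ≡ σ′
  sign-≡ m Sign.+ Sign.+ _ _ = refl
  sign-≡ m Sign.- Sign.- _ _ = refl
  sign-≡ m {v} {c} Sign.+ Sign.- (p , _) (q , z) = sym (z (opp⇒zero m {v} c p q))
  sign-≡ m {v} {c} Sign.- Sign.+ (p , z) (q , _) = z (opp⇒zero m {v} c q p)

  row-≡ : ∀ m {v p q} → IsRowPair m v p → IsRowPair m v q → p ≡ q
  row-≡ m {v} {c , σ} {d , σ′} hp hq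
    with refl ← class-≡ m {v} {c} {d} (row⇒class m {v} {c} {σ} hp) (row⇒class m {v} {d} {σ′} hq) = cong (c ,_) (sign-≡ m {v} σ σ′ hp hq)

  row-∃ : ∀ m v → ∃ (IsRowPair m v)
  row-∃ m v with v %ℕ t m ℕ.≤? m
  ... | yes r≤m = (fromℕ< (ℕ.s≤s r≤m) , Sign.+) , divides (v /ℕ t m) eq , λ _ → refl
    where
    open ≡-Reasoning
    lem : ∀ r qt → 1ℤ * (r + qt) - r ≡ qt
    lem = solve-∀
    eq : 1ℤ * v - + toℕ (fromℕ< (ℕ.s≤s r≤m)) ≡ (v /ℕ t m) * + t m
    eq = begin
      1ℤ * v - + toℕ (fromℕ< (ℕ.s≤s r≤m))
        ≡⟨ cong₂ (λ a c → 1ℤ * a - + c) (a≡a%ℕn+[a/ℕn]*n v (t m)) (toℕ-fromℕ< (ℕ.s≤s r≤m)) ⟩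
      1ℤ * (+ (v %ℕ t m) + (v /ℕ t m) * + t m) - + (v %ℕ t m)
        ≡⟨ lem (+ (v %ℕ t m)) _ ⟩
      (v /ℕ t m) * + t m ∎
  ... | no r≰m = (fromℕ< (ℕ.s≤s d≤m) , Sign.-) , divides (- (v /ℕ t m + 1ℤ)) eq , λ z →
        contradiction (trans (sym (toℕ-fromℕ< (ℕ.s≤s d≤m))) (cong toℕ z)) (ℕᵖ.m>n⇒m∸n≢0 r<t)
    where
    open ≡-Reasoning
    r = v %ℕ t m
    r<t : r ℕ.< t m
    r<t = n%ℕd<d v (t m)
    d≤m : t m ∸ r ℕ.≤ m
    d≤m = ℕᵖ.≤-trans (ℕᵖ.∸-monoʳ-≤ (t m) (ℕᵖ.≰⇒> r≰m))
            (ℕᵖ.≤-reflexive (trans (ℕᵖ.m+n∸m≡n m (m ℕ.+ 0)) (ℕᵖ.+-identityʳ m)))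
    lem : ∀ r q t → -1ℤ * (r + q * t) - (t - r) ≡ - (q + 1ℤ) * t
    lem = solve-∀
    eq : -1ℤ * v - + toℕ (fromℕ< (ℕ.s≤s d≤m)) ≡ - (v /ℕ t m + 1ℤ) * + t m
    eq = begin
      -1ℤ * v - + toℕ (fromℕ< (ℕ.s≤s d≤m))
        ≡⟨ cong₂ (λ a c → -1ℤ * a - c) (a≡a%ℕn+[a/ℕn]*n v (t m))
             (trans (cong +_ (toℕ-fromℕ< (ℕ.s≤s d≤m)))
               (sym (trans (m-n≡m⊖n (t m) r) (⊖-≥ (ℕᵖ.<⇒≤ r<t))))) ⟩
      -1ℤ * (+ r + (v /ℕ t m) * + t m) - (+ t m - + r)
        ≡⟨ lem (+ r) (v /ℕ t m) (+ t m) ⟩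
      - (v /ℕ t m + 1ℤ) * + t m ∎

foldedClass! : ∀ m a → ∃! _≡_ (IsFoldedClass m a)
foldedClass! m a = let (c , σ) , h = row-∃ m a in
  c , row⇒class m {a} {c} {σ} h , class-≡ m {a} {c} (row⇒class m {a} {c} {σ} h)

rowPair! : ∀ m v → ∃! _≡_ (IsRowPair m v)
rowPair! m v = let p , h = row-∃ m v in p , h , row-≡ m {v} {p} h

columnPair! : ∀ m x → ∃! _≡_ (IsColumnPair m x)
columnPair! m x = let p , h = row-∃ m x in
  p , row⇒column m {x} {p} h , λ {q} k → row-≡ m {x} {p} {q} h (column⇒row m {x} {q} k)

foldedClass : (m : ℕ) → ℤ → Fin (suc m)
foldedClass m a = proj₁ (foldedClass! m a)

foldingSign : ℕ → ℤ → Sign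
foldingSign m a =
  if does (+ t m ∣? a - + toℕ (foldedClass m a)) then Sign.+ else Sign.-

Odd : ℤ → Set
Odd k = ¬ (+ 2 ∣ k)

Hits : ℕ → ℤ → ℤ → Sign → Set
Hits m v x ε = ∃[ k ] (1ℤ ≤ k × Odd k × ⟦ ε ⟧ * v ≡ x + + t m * k)

hits? : ∀ m v x ε → Dec (Hits m v x ε)
hits? m v x ε with + t m ∣? ⟦ ε ⟧ * v - x
... | no ∤ = no λ (k , _ , _ , eq) →
  ∤ (divides k (trans (cong (_- x) eq) (lem x (+ t m) k)))
  where lem : ∀ x t k → x + t * k - x ≡ k * t
        lem = solve-∀
... | yes (divides q eq) =
  map′ (λ (1≤q , odd) → q , 1≤q , odd , reach) unreach (1ℤ ≤? q ×-dec ¬? (+ 2 ∣? q))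
  where
  lem₁ : ∀ a x → a ≡ x + (a - x)
  lem₁ = solve-∀
  lem₂ : ∀ x t q → x + q * t ≡ x + t * q
  lem₂ = solve-∀
  lem₃ : ∀ x t k → t * k ≡ x + t * k - x
  lem₃ = solve-∀
  lem₄ : ∀ t q → q * t ≡ t * q
  lem₄ = solve-∀
  reach : ⟦ ε ⟧ * v ≡ x + + t m * q
  reach = trans (lem₁ (⟦ ε ⟧ * v) x) (trans (cong (_+_ x) eq) (lem₂ x (+ t m) q))
  unreach : Hits m v x ε → 1ℤ ≤ q × Odd q
  unreach (k , 1≤k , odd , eq′) = subst (λ k → 1ℤ ≤ k × Odd k) k≡q (1≤k , odd)
    where
    k≡q : k ≡ q
    k≡q = *-cancelˡ-≡ (+ t m) k q (trans (lem₃ x (+ t m) k)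
            (trans (cong (_- x) (sym eq′)) (trans eq (lem₄ (+ t m) q))))

Matrix : ℕ → ℕ → Set
Matrix a b = Fin a → Fin b → ℤ

-- Rows and columns are numbered from 1 in the formulas; index i has number suc (toℕ i).

V : ∀ {R} → (Fin R → ℕ) → Fin R → ℤ
V {R} Λ i = + (2 ℕ.* Λ i ℕ.+ 2 ℕ.* (R ∸ suc (toℕ i)) ℕ.+ 1)

frozenEntry : (m : ℕ) → ℤ → Fin m → ℤ
frozenEntry m v j = let p = suc (toℕ j) in
  if does (toℕ (foldedClass m v) ℕ.≟ m ∸ p ℕ.+ 1) then ⟦ foldingSign m v ⟧ else 0ℤ

freeEntry : ℕ → ℤ → ℤ → ℤ
freeEntry m v x = foldr _+_ 0ℤ (map ⟦_⟧ (filter (hits? m v x) (Sign.+ ∷ Sign.- ∷ [])))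

module _ {R : ℕ} (m : ℕ) (Λ : Fin R → ℕ) where

  rowClass : Fin R → Fin (suc m)
  rowClass i = proj₁ (proj₁ (rowPair! m (V Λ i)))

  rowSign : Fin R → Sign
  rowSign i = proj₂ (proj₁ (rowPair! m (V Λ i)))

  w : Fin R → ℤ
  w i = ⟦ rowSign i ⟧ * V Λ i

  -- π sends a row to its position.
  OrdersRows : Permutation′ R → Set
  OrdersRows π = ∀ i i′ →
    ×-Lex _≡_ Fin._<_ _<_ (rowClass i , w i) (rowClass i′ , w i′) →
    (π ⟨$⟩ʳ i) Fin.< (π ⟨$⟩ʳ i′)

columnSign : ∀ m {r} → (Fin r → ℤ) → Fin (m ℕ.+ r) → Sign
columnSign m X j =
  [ (λ _ → Sign.+) , (λ k → proj₂ (proj₁ (columnPair! m (X k)))) ]′ (splitAt m j)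

module _ (m : ℕ) {r : ℕ} (Λ : Fin (m ℕ.+ r) → ℕ) (X : Fin r → ℤ) where

  M : Matrix (m ℕ.+ r) (m ℕ.+ r)
  M i j = [ frozenEntry m (V Λ i) , (λ k → freeEntry m (V Λ i) (X k)) ]′ (splitAt m j)

  -- Row p of M̂ comes from the row i of M with π(i) = p.
  M̂ : Permutation′ (m ℕ.+ r) → Matrix (m ℕ.+ r) (m ℕ.+ r)
  M̂ π p j = let i = π ⟨$⟩ˡ p in ⟦ rowSign m Λ i ⟧ * ⟦ columnSign m X j ⟧ * M i j

ZeroOne : ∀ {a b} → Matrix a b → Set
ZeroOne A = ∀ i j → A i j ≡ 0ℤ ⊎ A i j ≡ 1ℤ

ConsecutiveOnes : ∀ {a b} → Matrix a b → Set
ConsecutiveOnes A = ∀ j i₁ i₂ i₃ → i₁ Fin.≤ i₂ → i₂ Fin.≤ i₃ →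
  A i₁ j ≡ 1ℤ → A i₃ j ≡ 1ℤ → A i₂ j ≡ 1ℤ

-- Laplace expansion along the first row.
det : ∀ {n} → Matrix n n → ℤ
det {zero}  A = 1ℤ
det {suc n} A = sum +-0-commutativeMonoid λ j →
  -1ℤ ^ toℕ j * A zero j * det (λ i k → A (suc i) (punchIn j k))

StrictlyIncreasing : ∀ {k n} → (Fin k → Fin n) → Set
StrictlyIncreasing f = ∀ {i j} → i Fin.< j → f i Fin.< f j

TotallyUnimodular : ∀ {a b} → Matrix a b → Set
TotallyUnimodular {a} {b} A =
  ∀ k (f : Fin k → Fin a) (g : Fin k → Fin b) → StrictlyIncreasing f → StrictlyIncreasing g →
  let d = det (λ i j → A (f i) (g j)) in d ≡ -1ℤ ⊎ d ≡ 0ℤ ⊎ d ≡ 1ℤ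

{-# OPTIONS --safe #-}
-- Put w = σV for a row and x = X_j. In a free column the entry of M̂ is 1 exactly when
-- εV = x + tk has a solution (k ≥ 1 odd) for ε = στ but not for ε = −στ. Since V and t are odd,
-- it has one iff x is even, x < εV and εV ≡ x (mod t). Hence the ones lie in the single class
-- b_j and are cut out there by x < τw, together with −w ≤ x if b_j = 0: conditions that are
-- convex in w.
--
-- Total unimodularity uses column operations only, so that the order π and the order of
-- the rows in the Laplace expansion need not agree. Take the first row (for π) in which two
-- columns both have a one. If one of the two columns meets an earlier row, that row has no
-- other one, and the rest of the column can be cleared without changing the determinant.
-- Otherwise both intervals start in this row, so they are nested and the smaller one can be
-- subtracted from the larger. Both steps preserve the interval property and remove ones.
-- Once every row has at most one nonzero entry, the Laplace expansion has at most one term.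
module Submission where

open import Defs
open import Algebra.Bundles using (CommutativeRing)
import Algebra.Properties.CommutativeMonoid.Sum as CommutativeMonoidSum
import Algebra.Properties.Semiring.Sum as SemiringSum
open import Data.Bool as Bool using (Bool; true; false; _∧_; not; if_then_else_)
open import Data.Bool.Properties using (∧-zeroʳ; ∧-identityʳ)
open import Data.Fin as Fin
  using (Fin; zero; suc; toℕ; fromℕ<; inject₁; punchIn; punchOut; combine; remQuot; splitAt)
open import Data.Fin.Induction using (<-wellFounded)
open import Data.Fin.Permutation using (permutation; _⟨$⟩ʳ_; _⟨$⟩ˡ_; inverseˡ; inverseʳ)
open import Data.Fin.Permutation.Components using (transpose)
open import Data.Fin.Properties as Finᵖ
  using (any?; injective⇒≤; punchIn-injective; punchInᵢ≢i; punchIn-punchOut; punchOut-injective;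
         remQuot-combine; suc-injective; toℕ-fromℕ<; toℕ-inject₁)
open import Data.Fin.Subset using (Subset; _⊂_; _∈_; _∉_) renaming (∣_∣ to card)
open import Data.Fin.Subset.Induction using (⊂-wellFounded)
open import Data.Fin.Subset.Properties using (∈⊤; p⊂q⇒∣p∣<∣q∣; ∣⊤∣≡n)
open import Data.Integer as ℤ
  using (ℤ; +_; 0ℤ; 1ℤ; -1ℤ; _*_; -_; _-_; _^_; _%ℕ_; _/ℕ_; +<+)
open import Data.Integer.Divisibility.Signed
  using (_∣_; divides; _∣?_; ∣m∣n⇒∣m-n; ∣m∣n⇒∣m+n; ∣n⇒∣m*n; ∣⇒∣ᵤ)
open import Data.Integer.DivMod using (a≡a%ℕn+[a/ℕn]*n; n%ℕd<d)
import Data.Integer.Properties as ℤᵖ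
open import Data.Integer.Tactic.RingSolver using (solve-∀)
open import Data.List using ([]; _∷_; filter; foldr; map)
open import Data.Nat as ℕ using (ℕ; zero; suc; _+_; _≤_; _∸_)
import Data.Nat.Divisibility as ℕᵈ
import Data.Nat.Properties as ℕᵖ
open import Data.Product using (_×_; ∃-syntax; _,_; proj₁; proj₂; uncurry)
open import Data.Product.Relation.Binary.Lex.Strict using (×-Lex; ×-strictTotalOrder)
open import Data.Sign as Sign using (Sign; opposite)
open import Data.Sum as Sum using (_⊎_; inj₁; inj₂; [_,_]′)
open import Data.Vec using (lookup; tabulate)
open import Data.Vec.Functional using (updateAt)
open import Data.Vec.Functional.Properties using (updateAt-updates; updateAt-minimal)
open import Data.Vec.Properties using (lookup⇒[]=; []=⇒lookup; lookup∘tabulate)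
open import Function using (_∘_; Injective)
open import Induction.WellFounded using (Acc; acc)
open import Relation.Binary
  using (Rel; Transitive; Irreflexive; Trichotomous; Tri; tri<; tri≈; tri>; StrictTotalOrder)
open import Relation.Binary.PropositionalEquality
  using (_≡_; _≢_; refl; sym; trans; cong; cong₂; subst; subst₂; module ≡-Reasoning)
open import Relation.Nullary using (¬_; Dec; yes; no; does; contradiction)
open import Relation.Nullary.Decidable using (dec-true; dec-false; _×-dec_; ¬?)

open CommutativeMonoidSum ℤᵖ.+-0-commutativeMonoid using (sum; sum-cong-≗; ∑-distrib-+)
open SemiringSum (CommutativeRing.semiring ℤᵖ.+-*-commutativeRing) using (*-distribˡ-sum)

-- Column operations on the Laplace expansion

minor : ∀ {n} → Matrix (suc n) (suc n) → Fin (suc n) → Matrix n n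
minor A j i k = A (suc i) (punchIn j k)

laplaceTerm : ∀ {n} → Matrix (suc n) (suc n) → Fin (suc n) → ℤ
laplaceTerm A j = -1ℤ ^ toℕ j * A zero j * det (minor A j)

det-cong : ∀ {n} {A B : Matrix n n} → (∀ i j → A i j ≡ B i j) → det A ≡ det B
det-cong {zero}  A≗B = refl
det-cong {suc n} A≗B = sum-cong-≗ λ j →
  cong₂ (λ a d → -1ℤ ^ toℕ j * a * d) (A≗B zero j) (det-cong λ i k → A≗B (suc i) (punchIn j k))

-- In the term of column `c` the minors of `A`, `B`, `C` agree and the entry splits. In every other
-- term the entry is shared and the minor splits by induction, column `c` having moved to
-- `punchOut j≢c`.
det-linear : ∀ {n} {A B C : Matrix n n} c x →
  (∀ i → A i c ≡ B i c ℤ.+ x * C i c) →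
  (∀ i j → j ≢ c → A i j ≡ B i j) → (∀ i j → j ≢ c → A i j ≡ C i j) →
  det A ≡ det B ℤ.+ x * det C
det-linear {suc n} {A} {B} {C} c x col A≗B A≗C = begin
  sum (laplaceTerm A)
    ≡⟨ sum-cong-≗ term ⟩
  sum (λ j → laplaceTerm B j ℤ.+ x * laplaceTerm C j)
    ≡⟨ ∑-distrib-+ (laplaceTerm B) (λ j → x * laplaceTerm C j) ⟩
  det B ℤ.+ sum (λ j → x * laplaceTerm C j)
    ≡⟨ cong (ℤ._+_ (det B)) (*-distribˡ-sum x (laplaceTerm C)) ⟨
  det B ℤ.+ x * det C ∎
  where
  open ≡-Reasoning
  ring₁ : ∀ s b y c d → s * (b ℤ.+ y * c) * d ≡ s * b * d ℤ.+ y * (s * c * d)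
  ring₁ = solve-∀
  ring₂ : ∀ s a y d e → s * a * (d ℤ.+ y * e) ≡ s * a * d ℤ.+ y * (s * a * e)
  ring₂ = solve-∀
  atColumn : ∀ s {a b c d e f} → a ≡ b ℤ.+ x * c → d ≡ e → d ≡ f →
    s * a * d ≡ s * b * e ℤ.+ x * (s * c * f)
  atColumn s {_} {b} {c} {d} refl refl refl = ring₁ s b x c d
  offColumn : ∀ s {a b c d e f} → a ≡ b → a ≡ c → d ≡ e ℤ.+ x * f →
    s * a * d ≡ s * b * e ℤ.+ x * (s * c * f)
  offColumn s {a} {e = e} {f} refl refl refl = ring₂ s a x e f
  away : ∀ {j k} (j≢c : j ≢ c) → k ≢ punchOut j≢c → punchIn j k ≢ c
  away {j} {k} j≢c k≢ eq = k≢ (punchIn-injective j k _ (trans eq (sym (punchIn-punchOut j≢c))))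
  term : ∀ j → laplaceTerm A j ≡ laplaceTerm B j ℤ.+ x * laplaceTerm C j
  term j with j Finᵖ.≟ c
  ... | yes refl = atColumn (-1ℤ ^ toℕ j) (col zero)
    (det-cong λ i k → A≗B (suc i) _ (punchInᵢ≢i j k))
    (det-cong λ i k → A≗C (suc i) _ (punchInᵢ≢i j k))
  ... | no j≢c = offColumn (-1ℤ ^ toℕ j) (A≗B zero j j≢c) (A≗C zero j j≢c)
    (det-linear {A = minor A j} {minor B j} {minor C j} (punchOut j≢c) x
      (λ i → subst (λ c → A (suc i) c ≡ B (suc i) c ℤ.+ x * C (suc i) c)
               (sym (punchIn-punchOut j≢c)) (col (suc i)))
      (λ i k k≢ → A≗B (suc i) _ (away j≢c k≢)) (λ i k k≢ → A≗C (suc i) _ (away j≢c k≢)))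

sum-neg : ∀ {n} {f g : Fin n → ℤ} → (∀ j → f j ≡ - g j) → sum f ≡ - sum g
sum-neg {zero}          f≗-g = refl
sum-neg {suc n} {f} {g} f≗-g =
  trans (cong₂ ℤ._+_ (f≗-g zero) (sum-neg (f≗-g ∘ suc))) (sym (ℤᵖ.neg-distrib-+ (g zero) _))

-- The pattern of two Laplace expansions related by a swap of adjacent columns: the two terms trade
-- places, and all terms change sign.
sum-swap-neg : ∀ {n} {f g : Fin (suc n) → ℤ} i →
  f (inject₁ i) ≡ - g (suc i) → f (suc i) ≡ - g (inject₁ i) →
  (∀ j → j ≢ inject₁ i → j ≢ suc i → f j ≡ - g j) → sum f ≡ - sum g
sum-swap-neg {suc n} {f} {g} zero p q rest =
  trans (cong₂ ℤ._+_ p (cong₂ ℤ._+_ q (sum-neg λ j → rest (suc (suc j)) (λ ()) (λ ()))))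
        (lem (g zero) (g (suc zero)) _)
  where
  lem : ∀ a b s → - b ℤ.+ (- a ℤ.+ - s) ≡ - (a ℤ.+ (b ℤ.+ s))
  lem = solve-∀
sum-swap-neg {suc n} {f} {g} (suc i) p q rest =
  trans (cong₂ ℤ._+_ (rest zero (λ ()) (λ ()))
          (sum-swap-neg i p q λ j a b → rest (suc j) (a ∘ suc-injective) (b ∘ suc-injective)))
        (sym (ℤᵖ.neg-distrib-+ (g zero) _))

-- Keeps the induction on minors in `det-swap-adjacent` within adjacent pairs: deleting a third
-- column does not separate the two.
punchIn-adjacent : ∀ {n} (j : Fin (suc (suc n))) i → j ≢ inject₁ i → j ≢ suc i →
  ∃[ i′ ] punchIn j (inject₁ i′) ≡ inject₁ i × punchIn j (suc i′) ≡ suc i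
punchIn-adjacent         zero                zero    j≢ _  = contradiction refl j≢
punchIn-adjacent         zero                (suc i) _  _  = i , refl , refl
punchIn-adjacent         (suc zero)          zero    _  j≢ = contradiction refl j≢
punchIn-adjacent {suc n} (suc (suc j))       zero    _  _  = zero , refl , refl
punchIn-adjacent {suc n} (suc j)             (suc i) p  q
  with i′ , a , b ← punchIn-adjacent j i (p ∘ cong suc) (q ∘ cong suc)
  = suc i′ , cong suc a , cong suc b

-- Deleting one or the other of two adjacent columns leaves the same list, except that the survivor
-- of the pair differs.
punchIn-inject₁-suc : ∀ {n} (i k : Fin n) →
  (punchIn (inject₁ i) k ≡ suc i × punchIn (suc i) k ≡ inject₁ i) ⊎
  (punchIn (inject₁ i) k ≡ punchIn (suc i) k × punchIn (suc i) k ≢ inject₁ i)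
punchIn-inject₁-suc zero    zero    = inj₁ (refl , refl)
punchIn-inject₁-suc zero    (suc k) = inj₂ (refl , λ ())
punchIn-inject₁-suc (suc i) zero    = inj₂ (refl , λ ())
punchIn-inject₁-suc (suc i) (suc k) with punchIn-inject₁-suc i k
... | inj₁ (a , b) = inj₁ (cong suc a , cong suc b)
... | inj₂ (a , b) = inj₂ (cong suc a , b ∘ suc-injective)

-- For the two swapped columns the minors coincide and the Laplace signs differ by one factor -1;
-- for any other column the minor changes sign by induction.
det-swap-adjacent : ∀ {n} {A B : Matrix (suc n) (suc n)} i →
  (∀ r → A r (inject₁ i) ≡ B r (suc i)) → (∀ r → A r (suc i) ≡ B r (inject₁ i)) →
  (∀ r j → j ≢ inject₁ i → j ≢ suc i → A r j ≡ B r j) → det A ≡ - det B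
det-swap-adjacent {suc n} {A} {B} i p q rest = sum-swap-neg {f = laplaceTerm A} i left right others
  where
  minors : ∀ r k → A (suc r) (punchIn (inject₁ i) k) ≡ B (suc r) (punchIn (suc i) k)
  minors r k with punchIn-inject₁-suc i k
  ... | inj₁ (a , b)  = trans (cong (A _) a) (trans (q _) (cong (B _) (sym b)))
  ... | inj₂ (a , b≢) = trans (cong (A _) a) (rest _ _ b≢ (punchInᵢ≢i (suc i) k))
  minors′ : ∀ r k → A (suc r) (punchIn (suc i) k) ≡ B (suc r) (punchIn (inject₁ i) k)
  minors′ r k with punchIn-inject₁-suc i k
  ... | inj₁ (a , b)  = trans (cong (A _) b) (trans (p _) (cong (B _) (sym a)))
  ... | inj₂ (a , b≢) = trans (rest _ _ b≢ (punchInᵢ≢i (suc i) k)) (cong (B _) (sym a))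
  ringˡ : ∀ s a d → s * a * d ≡ - (-1ℤ * s * a * d)
  ringˡ = solve-∀
  ringʳ : ∀ s a d → -1ℤ * s * a * d ≡ - (s * a * d)
  ringʳ = solve-∀
  ringᶜ : ∀ s a d → s * a * (- d) ≡ - (s * a * d)
  ringᶜ = solve-∀
  signˡ : ∀ {s s′ a b d e} → s ≡ s′ → a ≡ b → d ≡ e → s * a * d ≡ - (-1ℤ * s′ * b * e)
  signˡ {s} {_} {a} {_} {d} refl refl refl = ringˡ s a d
  signʳ : ∀ {s s′ a b d e} → s ≡ s′ → a ≡ b → d ≡ e → -1ℤ * s′ * a * d ≡ - (s * b * e)
  signʳ {s} {_} {a} {_} {d} refl refl refl = ringʳ s a d
  signᶜ : ∀ s {a b d e} → a ≡ b → d ≡ - e → s * a * d ≡ - (s * b * e)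
  signᶜ s {a} {_} {_} {e} refl refl = ringᶜ s a e
  power : -1ℤ ^ toℕ (inject₁ i) ≡ -1ℤ ^ toℕ i
  power = cong (-1ℤ ^_) (toℕ-inject₁ i)
  left : laplaceTerm A (inject₁ i) ≡ - laplaceTerm B (suc i)
  left = signˡ power (p zero) (det-cong minors)
  right : laplaceTerm A (suc i) ≡ - laplaceTerm B (inject₁ i)
  right = signʳ power (q zero) (det-cong minors′)
  others : ∀ j → j ≢ inject₁ i → j ≢ suc i → laplaceTerm A j ≡ - laplaceTerm B j
  others j a b with i′ , c , d ← punchIn-adjacent j i a b =
    signᶜ (-1ℤ ^ toℕ j) (rest zero j a b)
      (det-swap-adjacent {A = minor A j} {minor B j} i′
        (λ r → trans (cong (A _) c) (trans (p _) (cong (B _) (sym d))))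
        (λ r → trans (cong (A _) d) (trans (q _) (cong (B _) (sym c))))
        (λ r k u v → rest _ _
          (λ e → u (punchIn-injective j k _ (trans e (sym c))))
          (λ e → v (punchIn-injective j k _ (trans e (sym d))))))

transpose-left : ∀ {n} (i j : Fin n) → transpose i j i ≡ j
transpose-left i j rewrite dec-true (i Finᵖ.≟ i) refl = refl

transpose-right : ∀ {n} (i j : Fin n) → i ≢ j → transpose i j j ≡ i
transpose-right i j i≢j
  rewrite dec-false (j Finᵖ.≟ i) (i≢j ∘ sym) | dec-true (j Finᵖ.≟ j) refl = refl

transpose-other : ∀ {n} {i j k : Fin n} → k ≢ i → k ≢ j → transpose i j k ≡ k
transpose-other {i = i} {j} {k} k≢i k≢j
  rewrite dec-false (k Finᵖ.≟ i) k≢i | dec-false (k Finᵖ.≟ j) k≢j = refl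

i≡-i⇒i≡0 : ∀ {i} → i ≡ - i → i ≡ 0ℤ
i≡-i⇒i≡0 {ℤ.+ zero} _ = refl

-- Adjacent swaps move column `b` left until it is next to `a`; one more swap then fixes the matrix,
-- so the determinant equals its negative. The recursion runs on `m`, the number of `b`, because
-- `inject₁ b` is not a subterm.
det-equal-columns-< : ∀ m {n} {A : Matrix n n} a b → toℕ b ≡ m → a Fin.< b →
  (∀ r → A r a ≡ A r b) → det A ≡ 0ℤ
det-equal-columns-< (suc m) {suc n} {A} a (suc b) b≡m a<b eq with a Finᵖ.≟ inject₁ b
... | yes refl = i≡-i⇒i≡0 (det-swap-adjacent {A = A} {A} b eq (λ r → sym (eq r)) (λ _ _ _ _ → refl))
... | no a≢b = trans swapped (cong -_ (det-equal-columns-< m {A = B} a (inject₁ b)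
    (trans (toℕ-inject₁ b) (ℕᵖ.suc-injective b≡m)) a<inject₁b
    λ r → trans (cong (A r) (transpose-other a≢b a≢suc))
            (trans (eq r) (cong (A r) (sym (transpose-left (inject₁ b) (suc b)))))))
  where
  inject₁≢suc : inject₁ b ≢ suc b
  inject₁≢suc e = ℕᵖ.1+n≢n (sym (trans (sym (toℕ-inject₁ b)) (cong toℕ e)))
  a≢suc : a ≢ suc b
  a≢suc refl = ℕᵖ.<-irrefl refl a<b
  a<inject₁b : a Fin.< inject₁ b
  a<inject₁b = ℕᵖ.≤∧≢⇒< (subst (toℕ a ≤_) (sym (toℕ-inject₁ b)) (ℕᵖ.≤-pred a<b))
    (a≢b ∘ Finᵖ.toℕ-injective)
  B : Matrix (suc n) (suc n)
  B r j = A r (transpose (inject₁ b) (suc b) j)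
  swapped : det A ≡ - det B
  swapped = det-swap-adjacent {A = A} {B} b
    (λ r → cong (A r) (sym (transpose-right (inject₁ b) (suc b) inject₁≢suc)))
    (λ r → cong (A r) (sym (transpose-left (inject₁ b) (suc b))))
    (λ r j u v → cong (A r) (sym (transpose-other u v)))

det-equal-columns : ∀ {n} {A : Matrix n n} a b → a ≢ b → (∀ r → A r a ≡ A r b) → det A ≡ 0ℤ
det-equal-columns {A = A} a b a≢b eq with Finᵖ.<-cmp a b
... | tri< a<b _ _ = det-equal-columns-< _ {A = A} a b refl a<b eq
... | tri≈ _ a≡b _ = contradiction a≡b a≢b
... | tri> _ _ b<a = det-equal-columns-< _ {A = A} b a refl b<a (sym ∘ eq)

-- By linearity the change is `x` times the determinant of `C`, in which column `b` is a copy of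
-- column `a`.
det-add-column : ∀ {n} {A B : Matrix n n} {a b} x → a ≢ b →
  (∀ r → B r b ≡ A r b ℤ.+ x * A r a) → (∀ r j → j ≢ b → B r j ≡ A r j) → det B ≡ det A
det-add-column {n} {A} {B} {a} {b} x a≢b col rest = begin
  det B                    ≡⟨ det-linear {A = B} {A} {C} b x
                                (λ r → trans (col r) (cong (λ y → A r b ℤ.+ x * y)
                                  (sym (updateAt-updates b (A r)))))
                                rest
                                (λ r j j≢b → trans (rest r j j≢b) (sym (updateAt-minimal j b (A r) j≢b))) ⟩
  det A ℤ.+ x * det C      ≡⟨ cong (λ d → det A ℤ.+ x * d) (det-equal-columns {A = C} a b a≢b λ r →
                                trans (updateAt-minimal a b (A r) a≢b) (sym (updateAt-updates b (A r)))) ⟩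
  det A ℤ.+ x * 0ℤ         ≡⟨ lem (det A) x ⟩
  det A                    ∎
  where
  open ≡-Reasoning
  C : Matrix n n
  C r = updateAt (A r) b (λ _ → A r a)
  lem : ∀ d x → d ℤ.+ x * 0ℤ ≡ d
  lem = solve-∀

sum-zero : ∀ {n} {f : Fin n → ℤ} → (∀ j → f j ≡ 0ℤ) → sum f ≡ 0ℤ
sum-zero {zero}  f≗0 = refl
sum-zero {suc n} f≗0 = cong₂ ℤ._+_ (f≗0 zero) (sum-zero (f≗0 ∘ suc))

det-zero-row : ∀ {n} {A : Matrix n n} r → (∀ j → A r j ≡ 0ℤ) → det A ≡ 0ℤ
det-zero-row {suc n} {A} zero    row = sum-zero λ j → vanish (-1ℤ ^ toℕ j) (det (minor A j)) (row j)
  where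
  ring : ∀ s d → s * 0ℤ * d ≡ 0ℤ
  ring = solve-∀
  vanish : ∀ s {a} d → a ≡ 0ℤ → s * a * d ≡ 0ℤ
  vanish s d refl = ring s d
det-zero-row {suc n} {A} (suc r) row = sum-zero λ j →
  trans (cong (-1ℤ ^ toℕ j * A zero j *_) (det-zero-row {A = minor A j} r λ k → row (punchIn j k)))
        (ℤᵖ.*-zeroʳ (-1ℤ ^ toℕ j * A zero j))

-- The difference of the two determinants is a determinant whose row r vanishes.
det-singleton-row : ∀ {n} {A B : Matrix n n} r c → (∀ j → j ≢ c → A r j ≡ 0ℤ) → A r c ≡ B r c →
  (∀ i j → j ≢ c → A i j ≡ B i j) → det A ≡ det B
det-singleton-row {n} {A} {B} r c row pivot rest = begin
  det A                    ≡⟨ det-linear {A = A} {B} {C} c 1ℤ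
                                (λ i → trans (lem (A i c) (B i c)) (cong (λ y → B i c ℤ.+ 1ℤ * y)
                                  (sym (updateAt-updates c (A i)))))
                                rest
                                (λ i j j≢c → sym (updateAt-minimal j c (A i) j≢c)) ⟩
  det B ℤ.+ 1ℤ * det C     ≡⟨ cong (λ d → det B ℤ.+ 1ℤ * d) (det-zero-row {A = C} r zeroRow) ⟩
  det B ℤ.+ 0ℤ             ≡⟨ ℤᵖ.+-identityʳ (det B) ⟩
  det B                    ∎
  where
  open ≡-Reasoning
  C : Matrix n n
  C i = updateAt (A i) c (λ x → x - B i c)
  lem : ∀ a b → a ≡ b ℤ.+ 1ℤ * (a - b)
  lem = solve-∀
  zeroRow : ∀ j → C r j ≡ 0ℤ
  zeroRow j with j Finᵖ.≟ c
  ... | yes refl = trans (updateAt-updates c (A r)) (ℤᵖ.i≡j⇒i-j≡0 pivot)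
  ... | no j≢c   = trans (updateAt-minimal j c (A r) j≢c) (row j j≢c)

-- Matrices with at most one nonzero entry in each row

SignOrZero : ℤ → Set
SignOrZero z = z ≡ -1ℤ ⊎ z ≡ 0ℤ ⊎ z ≡ 1ℤ

SignOrZero-* : ∀ {x y} → SignOrZero x → SignOrZero y → SignOrZero (x * y)
SignOrZero-* {y = y} (inj₂ (inj₁ refl)) _                  = inj₂ (inj₁ refl)
SignOrZero-* (inj₁ refl)                (inj₁ refl)        = inj₂ (inj₂ refl)
SignOrZero-* (inj₁ refl)                (inj₂ (inj₁ refl)) = inj₂ (inj₁ refl)
SignOrZero-* (inj₁ refl)                (inj₂ (inj₂ refl)) = inj₁ refl
SignOrZero-* (inj₂ (inj₂ refl))         (inj₁ refl)        = inj₁ refl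
SignOrZero-* (inj₂ (inj₂ refl))         (inj₂ (inj₁ refl)) = inj₂ (inj₁ refl)
SignOrZero-* (inj₂ (inj₂ refl))         (inj₂ (inj₂ refl)) = inj₂ (inj₂ refl)

SignOrZero-^ : ∀ n → SignOrZero (-1ℤ ^ n)
SignOrZero-^ zero    = inj₂ (inj₂ refl)
SignOrZero-^ (suc n) = SignOrZero-* (inj₁ refl) (SignOrZero-^ n)

SignOrZero-sum : ∀ {n} {f : Fin n → ℤ} → (∀ j → SignOrZero (f j)) →
  (∀ j k → f j ≢ 0ℤ → f k ≢ 0ℤ → j ≡ k) → SignOrZero (sum f)
SignOrZero-sum {zero}          units unique = inj₂ (inj₁ refl)
SignOrZero-sum {suc n} {f} units unique with f zero ℤᵖ.≟ 0ℤ
... | yes f₀≡0 = subst SignOrZero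
  (sym (trans (cong (λ x → x ℤ.+ sum (f ∘ suc)) f₀≡0) (ℤᵖ.+-identityˡ _)))
  (SignOrZero-sum (units ∘ suc) λ j k p q → suc-injective (unique (suc j) (suc k) p q))
... | no f₀≢0 = subst SignOrZero
  (sym (trans (cong (ℤ._+_ (f zero)) (sum-zero tail≗0)) (ℤᵖ.+-identityʳ _)))
  (units zero)
  where
  tail≗0 : ∀ j → f (suc j) ≡ 0ℤ
  tail≗0 j with f (suc j) ℤᵖ.≟ 0ℤ
  ... | yes p = p
  ... | no ¬p with () ← unique zero (suc j) f₀≢0 ¬p

det-thin-rows : ∀ {n} {A : Matrix n n} → (∀ i j → SignOrZero (A i j)) →
  (∀ i j k → A i j ≢ 0ℤ → A i k ≢ 0ℤ → j ≡ k) → SignOrZero (det A)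
det-thin-rows {zero}      units thin = inj₂ (inj₂ refl)
det-thin-rows {suc n} {A} units thin = SignOrZero-sum
  (λ j → SignOrZero-* (SignOrZero-* (SignOrZero-^ (toℕ j)) (units zero j))
    (det-thin-rows (λ i k → units (suc i) (punchIn j k))
      λ i k l p q → punchIn-injective j k l (thin (suc i) _ _ p q)))
  λ j k p q → thin zero j k (entry≢0 j p) (entry≢0 k q)
  where
  entry≢0 : ∀ j → laplaceTerm A j ≢ 0ℤ → A zero j ≢ 0ℤ
  entry≢0 j term≢0 a≡0 = term≢0 (cong (_* det (minor A j))
    (trans (cong (-1ℤ ^ toℕ j *_) a≡0) (ℤᵖ.*-zeroʳ (-1ℤ ^ toℕ j))))

-- Determinants of signed interval matrices

Incidence : ℕ → Set
Incidence k = Fin k → Fin k → Bool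

-- The termination measure of the reduction: positions are flattened to one index, so that strict
-- inclusion of finite subsets is available as a well-founded order.
support : ∀ {k} → Incidence k → Subset (k ℕ.* k)
support {k} N = tabulate (uncurry N ∘ remQuot k)

module _ {k : ℕ} (N : Incidence k) (c : Fin k) (keep : Fin k → Bool) where

  -- The common form of both reduction steps: clearing takes `only i` for `keep`, subtracting takes
  -- `avoiding N j`.
  trimColumn : Incidence k
  trimColumn i = updateAt (N i) c (_∧ keep i)

  trimColumn-at : ∀ i → trimColumn i c ≡ N i c ∧ keep i
  trimColumn-at i = updateAt-updates c (N i)

  trimColumn-off : ∀ i j → j ≢ c → trimColumn i j ≡ N i j
  trimColumn-off i j = updateAt-minimal j c (N i)

  trimColumn-⊆ : ∀ i j → trimColumn i j ≡ true → N i j ≡ true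
  trimColumn-⊆ i j eq with j Finᵖ.≟ c
  ... | no j≢c   = trans (sym (trimColumn-off i j j≢c)) eq
  ... | yes refl with N i c | trans (sym (trimColumn-at i)) eq
  ...   | true | _ = refl

  trimColumn-keeps : ∀ i → trimColumn i c ≡ true → keep i ≡ true
  trimColumn-keeps i eq with N i c | keep i | trans (sym (trimColumn-at i)) eq
  ... | true | true | _ = refl

  trimColumn-∋ : ∀ i → N i c ≡ true → keep i ≡ true → trimColumn i c ≡ true
  trimColumn-∋ i p q = trans (trimColumn-at i) (cong₂ _∧_ p q)

  trimColumn-⊂ : ∀ i → N i c ≡ true → keep i ≡ false → support trimColumn ⊂ support N
  trimColumn-⊂ i p q = (λ {x} x∈ → lookup⇒[]= x _ (trans (lookup∘tabulate _ x)
      (trimColumn-⊆ _ _ (trans (sym (lookup∘tabulate _ x)) ([]=⇒lookup x∈)))))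
    , combine i c
    , lookup⇒[]= _ _ (trans (at N) p)
    , λ x∈ → contradiction (trans (sym (trans (at trimColumn) (trans (trimColumn-at i)
        (trans (cong (N i c ∧_) q) (∧-zeroʳ _))))) ([]=⇒lookup x∈)) λ ()
    where
    at : ∀ (N : Incidence k) → lookup (support N) (combine i c) ≡ N i c
    at N = trans (lookup∘tabulate _ (combine i c)) (cong (uncurry N) (remQuot-combine i c))

only : ∀ {k} → Fin k → Fin k → Bool
only i a = does (a Finᵖ.≟ i)

avoiding : ∀ {k} → Incidence k → Fin k → Fin k → Bool
avoiding N j a = not (N a j)

bit : Bool → ℤ
bit b = if b then 1ℤ else 0ℤ

-- The signs stay in the matrix as factors, so the determinants studied are those of submatrices of
-- `M` itself.
signed : ∀ {k} (u v : Fin k → Sign) → Incidence k → Matrix k k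
signed u v N i j = ⟦ u i ⟧ * ⟦ v j ⟧ * bit (N i j)

SignOrZero-⟦⟧ : ∀ s → SignOrZero ⟦ s ⟧
SignOrZero-⟦⟧ Sign.+ = inj₂ (inj₂ refl)
SignOrZero-⟦⟧ Sign.- = inj₁ refl

SignOrZero-bit : ∀ b → SignOrZero (bit b)
SignOrZero-bit true  = inj₂ (inj₂ refl)
SignOrZero-bit false = inj₂ (inj₁ refl)

module _ {k R : ℕ} (ρ : Fin k → Fin R) where

  Convex : Incidence k → Set
  Convex N = ∀ j a b c → ρ a Fin.≤ ρ b → ρ b Fin.≤ ρ c →
    N a j ≡ true → N c j ≡ true → N b j ≡ true

  Fat : Incidence k → Fin k → Set
  Fat N i = ∃[ j ] ∃[ j′ ] (j ≢ j′ × N i j ≡ true × N i j′ ≡ true)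

  fat? : ∀ N i → Dec (Fat N i)
  fat? N i = any? λ j → any? λ j′ →
    ¬? (j Finᵖ.≟ j′) ×-dec (N i j Bool.≟ true) ×-dec (N i j′ Bool.≟ true)

  StartsBefore : Incidence k → Fin k → Fin k → Set
  StartsBefore N j i = ∃[ i′ ] (ρ i′ Fin.< ρ i × N i′ j ≡ true)

  startsBefore? : ∀ N j i → Dec (StartsBefore N j i)
  startsBefore? N j i = any? λ i′ → (ρ i′ Finᵖ.<? ρ i) ×-dec (N i′ j Bool.≟ true)

  -- Each step records a one that it removes: row `i′` of column `j` for `clear`, row `i` of column
  -- `j′` for `subtract`.
  data Reduction (N : Incidence k) : Set where
    clear    : ∀ i i′ j → i ≢ i′ → N i j ≡ true → N i′ j ≡ true → ¬ Fat N i → Reduction N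
    subtract : ∀ i j j′ → j ≢ j′ → N i j ≡ true → N i j′ ≡ true →
               ¬ StartsBefore N j i → ¬ StartsBefore N j′ i →
               (∀ i → N i j ≡ true → N i j′ ≡ true) → Reduction N

  least : ∀ N {i j} → ¬ StartsBefore N j i → ∀ a → N a j ≡ true → ρ i Fin.≤ ρ a
  least N none a p = ℕᵖ.≮⇒≥ λ a<i → none (a , a<i , p)

  -- If `a` came at or before `b`, it would lie between `i` and `b` and hence belong to column `j′`.
  -- So `b` lies between `i` and `a`, both of which are in column `j`.
  nested : ∀ N → Convex N → ∀ {i j j′} → N i j ≡ true → N i j′ ≡ true →
    ¬ StartsBefore N j i → ¬ StartsBefore N j′ i →
    ∀ a b → N a j ≡ true → N a j′ ≡ false → N b j′ ≡ true → N b j ≡ true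
  nested N convex {i} {j} {j′} p p′ none none′ a b q q′ r with Finᵖ.≤-total (ρ a) (ρ b)
  ... | inj₁ a≤b with () ← trans (sym q′) (convex j′ i a b (least N none a q) a≤b p′ r)
  ... | inj₂ b≤a = convex j i b a (least N none′ b r) b≤a p q

  -- Descent on `ρ i`: an earlier row met by one of the two columns is either fat, and the search
  -- moves there, or thin, and serves as pivot for clearing that column.
  findReduction : ∀ N → Convex N → ∀ i → Acc Fin._<_ (ρ i) → Fat N i → Reduction N
  findReduction N convex i (acc rec) (j , j′ , j≢j′ , p , p′)
    with startsBefore? N j i | startsBefore? N j′ i
  ... | yes (a , a<i , q) | _ with fat? N a
  ...   | yes fat = findReduction N convex a (rec a<i) fat
  ...   | no thin = clear a i j (λ { refl → ℕᵖ.<-irrefl refl a<i }) q p thin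
  findReduction N convex i (acc rec) (j , j′ , j≢j′ , p , p′)
      | no _ | yes (a , a<i , q) with fat? N a
  ...   | yes fat = findReduction N convex a (rec a<i) fat
  ...   | no thin = clear a i j′ (λ { refl → ℕᵖ.<-irrefl refl a<i }) q p′ thin
  findReduction N convex i (acc rec) (j , j′ , j≢j′ , p , p′)
      | no none | no none′
      with any? (λ a → (N a j Bool.≟ true) ×-dec (N a j′ Bool.≟ false))
  -- A one of `j` outside `j′` forces `j′` into `j`, so the two columns exchange roles.
  ...   | yes (a , q , q′) = subtract i j′ j (j≢j′ ∘ sym) p′ p none′ none
          (λ b → nested N convex p p′ none none′ a b q q′)
  ...   | no none″ = subtract i j j′ j≢j′ p p′ none none′ contained
    where
    contained : ∀ b → N b j ≡ true → N b j′ ≡ true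
    contained b q with N b j′ in eq
    ... | true  = refl
    ... | false = contradiction (b , q , eq) none″

  trimColumn-convex : ∀ N → Convex N → ∀ c keep →
    (∀ x y z → ρ x Fin.≤ ρ y → ρ y Fin.≤ ρ z → N x c ≡ true → N z c ≡ true → N y c ≡ true →
      keep x ≡ true → keep z ≡ true → keep y ≡ true) →
    Convex (trimColumn N c keep)
  trimColumn-convex N convex c keep inner j x y z x≤y y≤z p q with j Finᵖ.≟ c
  ... | no j≢c = trans (trimColumn-off N c keep y j j≢c)
    (convex j x y z x≤y y≤z (trimColumn-⊆ N c keep x j p) (trimColumn-⊆ N c keep z j q))
  ... | yes refl = trimColumn-∋ N c keep y y∈
    (inner x y z x≤y y≤z x∈ z∈ y∈ (trimColumn-keeps N c keep x p) (trimColumn-keeps N c keep z q))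
    where
    x∈ = trimColumn-⊆ N c keep x c p
    z∈ = trimColumn-⊆ N c keep z c q
    y∈ = convex c x y z x≤y y≤z x∈ z∈

  module _ (ρ-injective : ∀ {i i′} → ρ i ≡ ρ i′ → i ≡ i′) (u v : Fin k → Sign) where

    -- Since row `i` is not fat, its only one is in column `j`, and the other entries of that column
    -- do not affect the determinant.
    det-clear : ∀ N i j → N i j ≡ true → ¬ Fat N i →
      det (signed u v N) ≡ det (signed u v (trimColumn N j (only i)))
    det-clear N i j p thin = det-singleton-row {A = signed u v N} i j
      (λ j′ j′≢j → trans (cong (λ b → ⟦ u i ⟧ * ⟦ v j′ ⟧ * bit b) (others j′ j′≢j))
        (ℤᵖ.*-zeroʳ (⟦ u i ⟧ * ⟦ v j′ ⟧)))
      (cong (λ b → ⟦ u i ⟧ * ⟦ v j ⟧ * bit b)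
        (trans p (sym (trimColumn-∋ N j (only i) i p (dec-true (i Finᵖ.≟ i) refl)))))
      (λ a j′ j′≢j → cong (λ b → ⟦ u a ⟧ * ⟦ v j′ ⟧ * bit b)
        (sym (trimColumn-off N j (only i) a j′ j′≢j)))
      where
      others : ∀ j′ → j′ ≢ j → N i j′ ≡ false
      others j′ j′≢j with N i j′ in eq
      ... | false = refl
      ... | true  = contradiction (j′ , j , j′≢j , eq , p) thin

    -- Signs square to one, so the factor `- (⟦ t ⟧ * ⟦ t′ ⟧)` exchanges the column sign `t` for
    -- `t′`; the difference of the bits is again a bit because `b` implies `b′`.
    subtract-bit : ∀ s t t′ b b′ → (b ≡ true → b′ ≡ true) →
      ⟦ s ⟧ * ⟦ t′ ⟧ * bit (b′ ∧ not b) ≡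
      ⟦ s ⟧ * ⟦ t′ ⟧ * bit b′ ℤ.+ - (⟦ t ⟧ * ⟦ t′ ⟧) * (⟦ s ⟧ * ⟦ t ⟧ * bit b)
    subtract-bit s t t′ false b′ _ =
      trans (cong (λ b → ⟦ s ⟧ * ⟦ t′ ⟧ * bit b) (∧-identityʳ b′)) (ring ⟦ s ⟧ ⟦ t ⟧ ⟦ t′ ⟧ (bit b′))
      where
      ring : ∀ s t t′ b → s * t′ * b ≡ s * t′ * b ℤ.+ - (t * t′) * (s * t * 0ℤ)
      ring = solve-∀
    subtract-bit s t t′ true b′ sub with b′ | sub refl
    subtract-bit Sign.+ Sign.+ Sign.+ true _ _ | _ | refl = refl
    subtract-bit Sign.+ Sign.+ Sign.- true _ _ | _ | refl = refl
    subtract-bit Sign.+ Sign.- Sign.+ true _ _ | _ | refl = refl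
    subtract-bit Sign.+ Sign.- Sign.- true _ _ | _ | refl = refl
    subtract-bit Sign.- Sign.+ Sign.+ true _ _ | _ | refl = refl
    subtract-bit Sign.- Sign.+ Sign.- true _ _ | _ | refl = refl
    subtract-bit Sign.- Sign.- Sign.+ true _ _ | _ | refl = refl
    subtract-bit Sign.- Sign.- Sign.- true _ _ | _ | refl = refl

    det-subtract : ∀ N j j′ → j ≢ j′ → (∀ i → N i j ≡ true → N i j′ ≡ true) →
      det (signed u v (trimColumn N j′ (avoiding N j))) ≡ det (signed u v N)
    det-subtract N j j′ j≢j′ sub = det-add-column {A = signed u v N}
      (- (⟦ v j ⟧ * ⟦ v j′ ⟧)) j≢j′
      (λ r → trans (cong (λ b → ⟦ u r ⟧ * ⟦ v j′ ⟧ * bit b) (trimColumn-at N j′ (avoiding N j) r))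
               (subtract-bit (u r) (v j) (v j′) (N r j) (N r j′) (sub r)))
      (λ r c c≢j′ → cong (λ b → ⟦ u r ⟧ * ⟦ v c ⟧ * bit b)
        (trimColumn-off N j′ (avoiding N j) r c c≢j′))

    clear-convex : ∀ N → Convex N → ∀ i j → Convex (trimColumn N j (only i))
    clear-convex N convex i j = trimColumn-convex N convex j (only i) inner
      where
      inner : ∀ x y z → ρ x Fin.≤ ρ y → ρ y Fin.≤ ρ z → _ → _ → _ →
        does (x Finᵖ.≟ i) ≡ true → does (z Finᵖ.≟ i) ≡ true → does (y Finᵖ.≟ i) ≡ true
      inner x y z x≤y y≤z _ _ _ p q with x Finᵖ.≟ i | z Finᵖ.≟ i
      -- Both ends are row `i`, so `y` has the same position as `i`.
      ... | yes refl | yes refl = dec-true (y Finᵖ.≟ i) (ρ-injective (Finᵖ.≤-antisym y≤z x≤y))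

    -- Only an initial piece of column `j′` is removed: a surviving `x` comes after `i`, and a later
    -- `y` in column `j` would put `x`, between `i` and `y`, into column `j` too.
    subtract-convex : ∀ N → Convex N → ∀ i j j′ → N i j ≡ true → ¬ StartsBefore N j′ i →
      Convex (trimColumn N j′ (avoiding N j))
    subtract-convex N convex i j j′ p none = trimColumn-convex N convex j′ (avoiding N j) inner
      where
      inner : ∀ x y z → ρ x Fin.≤ ρ y → ρ y Fin.≤ ρ z →
        N x j′ ≡ true → N z j′ ≡ true → N y j′ ≡ true →
        not (N x j) ≡ true → not (N z j) ≡ true → not (N y j) ≡ true
      inner x y z x≤y y≤z x∈ _ _ q _ with N y j in eq
      ... | false = refl
      ... | true with N x j | convex j i x y (least N none x x∈) x≤y p eq
      ...   | true | _ = q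

    det-signed-convex : ∀ N → Acc _⊂_ (support N) → Convex N → SignOrZero (det (signed u v N))
    det-signed-convex N (acc rec) convex with any? (fat? N)
    ... | no thin = det-thin-rows
      (λ i j → SignOrZero-* (SignOrZero-* (SignOrZero-⟦⟧ (u i)) (SignOrZero-⟦⟧ (v j)))
        (SignOrZero-bit (N i j)))
      unique
      where
      entry : ∀ i j → signed u v N i j ≢ 0ℤ → N i j ≡ true
      entry i j ≢0 with N i j
      ... | true  = refl
      ... | false = contradiction (ℤᵖ.*-zeroʳ (⟦ u i ⟧ * ⟦ v j ⟧)) ≢0
      unique : ∀ i j j′ → signed u v N i j ≢ 0ℤ → signed u v N i j′ ≢ 0ℤ → j ≡ j′
      unique i j j′ p q with j Finᵖ.≟ j′
      ... | yes j≡j′ = j≡j′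
      ... | no j≢j′  = contradiction (i , j , j′ , j≢j′ , entry i j p , entry i j′ q) thin
    ... | yes (i₀ , fat) with findReduction N convex i₀ (<-wellFounded (ρ i₀)) fat
    ...   | clear i i′ j i≢i′ p p′ thin = subst SignOrZero (sym (det-clear N i j p thin))
            (det-signed-convex _
              (rec (trimColumn-⊂ N j (only i) i′ p′ (dec-false (i′ Finᵖ.≟ i) (i≢i′ ∘ sym))))
              (clear-convex N convex i j))
    ...   | subtract i j j′ j≢j′ p p′ none none′ sub = subst SignOrZero (det-subtract N j j′ j≢j′ sub)
            (det-signed-convex _ (rec (trimColumn-⊂ N j′ (avoiding N j) i p′ (cong not p)))
              (subtract-convex N convex i j j′ p none′))

-- Sorting a finite total order

does⇒proof : ∀ {p} {P : Set p} (P? : Dec P) → does P? ≡ true → P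
does⇒proof (yes p) _ = p

-- Pigeonhole: if `y` were missed, punching it out would inject `Fin (suc n)` into `Fin n`.
injective⇒surjective : ∀ {n} {f : Fin n → Fin n} → Injective _≡_ _≡_ f → ∀ y → ∃[ x ] f x ≡ y
injective⇒surjective {suc n} {f} f-injective y with any? (λ x → f x Finᵖ.≟ y)
... | yes hit = hit
... | no miss = contradiction (injective⇒≤ λ {i} {j} eq →
        f-injective (punchOut-injective (λ e → miss (i , sym e)) (λ e → miss (j , sym e)) eq))
      ℕᵖ.1+n≰n

module _ {n ℓ} {_≺_ : Rel (Fin n) ℓ} (≺-trans : Transitive _≺_) (≺-irrefl : Irreflexive _≡_ _≺_)
         (≺-cmp : Trichotomous _≡_ _≺_) where

  private
    _≺?_ : ∀ i j → Dec (i ≺ j)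
    i ≺? j with ≺-cmp i j
    ... | tri< i≺j _ _ = yes i≺j
    ... | tri≈ i⊀j _ _ = no i⊀j
    ... | tri> i⊀j _ _ = no i⊀j

    below : Fin n → Subset n
    below i = tabulate λ j → does (j ≺? i)

    ∈-below⁺ : ∀ {i j} → j ≺ i → j ∈ below i
    ∈-below⁺ {i} {j} j≺i = lookup⇒[]= j _ (trans (lookup∘tabulate _ j) (dec-true (j ≺? i) j≺i))

    ∈-below⁻ : ∀ {i j} → j ∈ below i → j ≺ i
    ∈-below⁻ {i} {j} j∈ = does⇒proof (j ≺? i)
      (trans (sym (lookup∘tabulate (λ j → does (j ≺? i)) j)) ([]=⇒lookup j∈))

    ∉-below : ∀ i → i ∉ below i
    ∉-below i = ≺-irrefl refl ∘ ∈-below⁻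

    ∣below∣<n : ∀ i → card (below i) ℕ.< n
    ∣below∣<n i = subst (card (below i) ℕ.<_) (∣⊤∣≡n n)
      (p⊂q⇒∣p∣<∣q∣ ((λ _ → ∈⊤) , i , ∈⊤ , ∉-below i))

    rank : Fin n → Fin n
    rank i = fromℕ< (∣below∣<n i)

    rank-mono : ∀ {i j} → i ≺ j → rank i Fin.< rank j
    rank-mono {i} {j} i≺j = subst₂ ℕ._<_ (sym (toℕ-fromℕ< (∣below∣<n i))) (sym (toℕ-fromℕ< (∣below∣<n j)))
      (p⊂q⇒∣p∣<∣q∣ ((λ x∈ → ∈-below⁺ (≺-trans (∈-below⁻ x∈) i≺j)) , i , ∈-below⁺ i≺j , ∉-below i))

    rank-injective : Injective _≡_ _≡_ rank
    rank-injective {i} {j} eq with ≺-cmp i j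
    ... | tri< i≺j _ _ = contradiction (rank-mono i≺j) (ℕᵖ.<-irrefl (cong toℕ eq))
    ... | tri≈ _ i≡j _ = i≡j
    ... | tri> _ _ j≺i = contradiction (rank-mono j≺i) (ℕᵖ.<-irrefl (cong toℕ (sym eq)))

  -- The position of an element is the number of its predecessors. This rank is strictly monotone,
  -- hence injective by trichotomy, hence bijective.
  sortingPermutation : ∃[ π ] (∀ i j → i ≺ j → (π ⟨$⟩ʳ i) Fin.< (π ⟨$⟩ʳ j))
  sortingPermutation = permutation rank unrank
      (λ y → proj₂ (onto y)) (λ x → rank-injective (proj₂ (onto (rank x))))
    , λ i j → rank-mono
    where
    onto = injective⇒surjective rank-injective
    unrank = λ y → proj₁ (onto y)

-- The entries of M̂

∣-resp : ∀ {n a b} → a ≡ b → n ∣ a → n ∣ b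
∣-resp = subst (_ ∣_)

odd⇒2∣pred : ∀ k → Odd k → + 2 ∣ k - 1ℤ
odd⇒2∣pred k odd with k %ℕ 2 | k /ℕ 2 | a≡a%ℕn+[a/ℕn]*n k 2 | n%ℕd<d k 2
... | 0           | q | eq | _ = contradiction (divides q (trans eq (ℤᵖ.+-identityˡ _))) odd
... | 1           | q | eq | _ = divides q (trans (cong (_- 1ℤ) eq) (lem (q * + 2)))
  where
  lem : ∀ y → 1ℤ ℤ.+ y - 1ℤ ≡ y
  lem = solve-∀
... | suc (suc _) | _ | _  | ℕ.s≤s (ℕ.s≤s ())

⟦⟧-* : ∀ s s′ → ⟦ s Sign.* s′ ⟧ ≡ ⟦ s ⟧ * ⟦ s′ ⟧
⟦⟧-* Sign.+ Sign.+ = refl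
⟦⟧-* Sign.+ Sign.- = refl
⟦⟧-* Sign.- Sign.+ = refl
⟦⟧-* Sign.- Sign.- = refl

⟦⟧-involutive : ∀ s i → ⟦ s ⟧ * (⟦ s ⟧ * i) ≡ i
⟦⟧-involutive Sign.+ = solve-∀
⟦⟧-involutive Sign.- = solve-∀

odd-⟦⟧* : ∀ ε {v} → Odd v → Odd (⟦ ε ⟧ * v)
odd-⟦⟧* ε {v} odd 2∣ = odd (∣-resp (⟦⟧-involutive ε v) (∣n⇒∣m*n ⟦ ε ⟧ 2∣))

module _ (m : ℕ) where

  private
    t≡ : + t m ≡ 1ℤ ℤ.+ + 2 * + m
    t≡ = trans (ℤᵖ.pos-+ 1 (2 ℕ.* m)) (cong (ℤ._+_ 1ℤ) (ℤᵖ.pos-* 2 m))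

  -- Together with `⇒hits` this trades the existential over `k` for three conditions, of which the
  -- parity of `x` depends on the column alone.
  hits⇒ : ∀ {v x} ε → Odd v → Hits m v x ε →
    + t m ∣ ⟦ ε ⟧ * v - x × + 2 ∣ x × x ℤ.< ⟦ ε ⟧ * v
  hits⇒ {v} {x} ε odd (k , 1≤k , kOdd , eq) =
      divides k (trans (cong (_- x) eq) (lem₁ x (+ t m) k))
    -- With e = `⟦ ε ⟧ * v`, the number x equals (e - 1) - (k - 1) - 2mk, a combination of even
    -- numbers.
    , ∣-resp
        (trans (cong (λ e → (e - 1ℤ) - (k - 1ℤ) - + 2 * (+ m * k))
                 (trans eq (cong (λ t → x ℤ.+ t * k) t≡)))
          (lem₂ x (+ m) k))
        (∣m∣n⇒∣m-n (∣m∣n⇒∣m-n (odd⇒2∣pred _ (odd-⟦⟧* ε odd)) (odd⇒2∣pred k kOdd))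
          (divides (+ m * k) (ℤᵖ.*-comm (+ 2) _)))
    , subst₂ ℤ._<_ (ℤᵖ.+-identityʳ x) (sym eq) (ℤᵖ.+-monoʳ-< x 0<tk)
    where
    lem₁ : ∀ x t k → x ℤ.+ t * k - x ≡ k * t
    lem₁ = solve-∀
    lem₂ : ∀ x m k → (x ℤ.+ (1ℤ ℤ.+ + 2 * m) * k - 1ℤ) - (k - 1ℤ) - + 2 * (m * k) ≡ x
    lem₂ = solve-∀
    0<tk : 0ℤ ℤ.< + t m * k
    0<tk = subst (ℤ._< + t m * k) (ℤᵖ.*-zeroʳ (+ t m))
      (ℤᵖ.*-monoˡ-<-pos (+ t m) (ℤᵖ.<-≤-trans (+<+ (ℕ.s≤s ℕ.z≤n)) 1≤k))

  -- The quotient `q` serves as `k`: if it were even, so would be `⟦ ε ⟧ * v`, and it is positive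
  -- because `q` times `t m` is.
  ⇒hits : ∀ {v x} ε → Odd v → + t m ∣ ⟦ ε ⟧ * v - x → + 2 ∣ x → x ℤ.< ⟦ ε ⟧ * v → Hits m v x ε
  ⇒hits {v} {x} ε odd (divides q eq) 2∣x x<e = q , 1≤q , qOdd , reach
    where
    lem₁ : ∀ e x → e ≡ x ℤ.+ (e - x)
    lem₁ = solve-∀
    reach : ⟦ ε ⟧ * v ≡ x ℤ.+ + t m * q
    reach = trans (lem₁ (⟦ ε ⟧ * v) x) (cong (ℤ._+_ x) (trans eq (ℤᵖ.*-comm q (+ t m))))
    qOdd : Odd q
    qOdd 2∣q = odd-⟦⟧* ε odd (∣-resp (sym reach) (∣m∣n⇒∣m+n 2∣x (∣n⇒∣m*n (+ t m) 2∣q)))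
    1≤q : 1ℤ ℤ.≤ q
    1≤q = ℤᵖ.i<j⇒suc[i]≤j (ℤᵖ.*-cancelʳ-<-nonNeg {0ℤ} {q} (+ t m)
      (subst₂ ℤ._<_ (ℤᵖ.+-inverseʳ x) eq (ℤᵖ.+-monoˡ-< (- x) x<e)))

opposite≢ : ∀ s → opposite s ≢ s
opposite≢ Sign.+ ()
opposite≢ Sign.- ()

*-cancel-sign : ∀ s s′ → s ≡ (s Sign.* s′) Sign.* s′
*-cancel-sign Sign.+ Sign.+ = refl
*-cancel-sign Sign.+ Sign.- = refl
*-cancel-sign Sign.- Sign.+ = refl
*-cancel-sign Sign.- Sign.- = refl

-- What the free columns use of a row, apart from positivity, with no reference to `Λ`.
OddRow : (m : ℕ) → ℤ → Fin (suc m) × Sign → Set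
OddRow m v p = Odd v × IsRowPair m v p × (∀ {q} → IsRowPair m v q → p ≡ q)

module FreeEntry (m : ℕ) {x : ℤ} {b : Fin (suc m)} {τ : Sign} (column : IsColumnPair m x (b , τ)) where

  private
    t∣ : ℤ → Set
    t∣ = + t m ∣_

    b≡0⇒t∣x : b ≡ zero → t∣ x
    b≡0⇒t∣x refl = ∣-resp (lem x ⟦ τ ⟧) (proj₁ column)
      where
      lem : ∀ x s → x - s * 0ℤ ≡ x
      lem = solve-∀

  -- From εv ≡ x ≡ τb follows (ετ)v ≡ b. For b ≠ 0 this is a row pair of `v`, and uniqueness yields
  -- both class and sign; for b = 0 it only yields v ≡ 0, leaving ε free.
  congruent⇒ : ∀ {v c σ} → OddRow m v (c , σ) → ∀ ε → t∣ (⟦ ε ⟧ * v - x) →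
    c ≡ b × (b ≢ zero → ε ≡ σ Sign.* τ)
  congruent⇒ {v} {c} {σ} (_ , _ , unique) ε h with b Finᵖ.≟ zero
  ... | yes b≡0 = trans (cong proj₁ (unique {zero , Sign.+} (∣-resp (lem v) t∣v , λ _ → refl))) (sym b≡0)
                , λ b≢0 → contradiction b≡0 b≢0
    where
    lem : ∀ v → v ≡ 1ℤ * v - 0ℤ
    lem = solve-∀
    lem₂ : ∀ e x → (e - x) ℤ.+ x ≡ e
    lem₂ = solve-∀
    t∣v : t∣ v
    t∣v = ∣-resp (⟦⟧-involutive ε v)
      (∣n⇒∣m*n ⟦ ε ⟧ (∣-resp (lem₂ (⟦ ε ⟧ * v) x) (∣m∣n⇒∣m+n h (b≡0⇒t∣x b≡0))))
  ... | no b≢0 = cong proj₁ eq , λ _ → trans (*-cancel-sign ε τ) (cong (Sign._* τ) (sym (cong proj₂ eq)))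
    where
    lem : ∀ e v s y x → s * ((e * v - x) ℤ.+ (x - s * y)) ≡ (e * s) * v - s * (s * y)
    lem = solve-∀
    eq : (c , σ) ≡ (b , ε Sign.* τ)
    eq = unique {b , ε Sign.* τ}
      ( ∣-resp (trans (lem ⟦ ε ⟧ v ⟦ τ ⟧ (+ toℕ b) x)
          (cong₂ (λ s y → s * v - y) (sym (⟦⟧-* ε τ)) (⟦⟧-involutive τ (+ toℕ b))))
          (∣n⇒∣m*n ⟦ τ ⟧ (∣m∣n⇒∣m+n h (proj₁ column)))
      , λ b≡0 → contradiction b≡0 b≢0)

  ⇒congruent : ∀ {v c σ} → OddRow m v (c , σ) → c ≡ b → t∣ (⟦ σ Sign.* τ ⟧ * v - x)
  ⇒congruent {v} {c} {σ} (_ , (h , _) , _) refl =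
    ∣-resp (trans (lem ⟦ σ ⟧ v ⟦ τ ⟧ (+ toℕ c) x) (cong (λ s → s * v - x) (sym (⟦⟧-* σ τ))))
      (∣m∣n⇒∣m-n (∣n⇒∣m*n ⟦ τ ⟧ h) (proj₁ column))
    where
    lem : ∀ e v s y x → s * (e * v - y) - (x - s * y) ≡ (e * s) * v - x
    lem = solve-∀

  ⇒congruent₀ : ∀ {v c σ} → OddRow m v (c , σ) → c ≡ b → b ≡ zero → ∀ ε → t∣ (⟦ ε ⟧ * v - x)
  ⇒congruent₀ {v} {c} {σ} (_ , (h , _) , _) refl refl ε =
    ∣m∣n⇒∣m-n (∣n⇒∣m*n ⟦ ε ⟧ t∣v) (b≡0⇒t∣x refl)
    where
    lem : ∀ y → y - 0ℤ ≡ y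
    lem = solve-∀
    t∣v : t∣ v
    t∣v = ∣-resp (⟦⟧-involutive σ v) (∣n⇒∣m*n ⟦ σ ⟧ (∣-resp (lem (⟦ σ ⟧ * v)) h))

  IsOne : ℤ → Sign → Set
  IsOne v σ = Hits m v x (σ Sign.* τ) × ¬ Hits m v x (opposite (σ Sign.* τ))

  -- Outside class zero `congruent⇒` would make a sign equal to its opposite; in class zero both
  -- signs are + by convention.
  oppositeHit : ∀ {v c σ} → OddRow m v (c , σ) → Hits m v x (opposite (σ Sign.* τ)) →
    c ≡ zero × b ≡ zero × σ ≡ Sign.+ × τ ≡ Sign.+
  oppositeHit {v} {c} {σ} row@(odd , (_ , c≡0⇒+) , _) hit
    with h , _ , _ ← hits⇒ m (opposite (σ Sign.* τ)) odd hit
    with c≡b , ε≡ ← congruent⇒ row (opposite (σ Sign.* τ)) h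
    with b Finᵖ.≟ zero
  ... | yes b≡0 = trans c≡b b≡0 , b≡0 , c≡0⇒+ (trans c≡b b≡0) , proj₂ column b≡0
  ... | no b≢0  = contradiction (ε≡ b≢0) (opposite≢ _)

  -- Excludes the entry -1 from `M̂`: an opposite hit occurs in class zero with x < -v < v, so the
  -- sign + hits as well.
  oppositeHit⇒hit : ∀ {v c σ} → OddRow m v (c , σ) → 0ℤ ℤ.< v →
    Hits m v x (opposite (σ Sign.* τ)) → Hits m v x (σ Sign.* τ)
  oppositeHit⇒hit {v} row@(odd , _) 0<v hit
    with c≡0 , b≡0 , refl , refl ← oppositeHit row hit
    with _ , 2∣x , x<-v ← hits⇒ m Sign.- odd hit =
    ⇒hits m Sign.+ odd (⇒congruent row (trans c≡0 (sym b≡0))) 2∣x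
      (ℤᵖ.<-trans x<-v (subst₂ ℤ._<_ (sym (ℤᵖ.-1*i≡-i v)) (sym (ℤᵖ.*-identityˡ v))
        (ℤᵖ.<-trans (ℤᵖ.neg-mono-< 0<v) 0<v)))

  IsOne⇒class : ∀ {v c σ} → OddRow m v (c , σ) → IsOne v σ → c ≡ b
  IsOne⇒class {σ = σ} row@(odd , _) (hit , _) = 
    proj₁ (congruent⇒ row (σ Sign.* τ) (proj₁ (hits⇒ m (σ Sign.* τ) odd hit)))

  private
    ⟦στ⟧ : ∀ σ v → ⟦ σ Sign.* τ ⟧ * v ≡ ⟦ τ ⟧ * (⟦ σ ⟧ * v)
    ⟦στ⟧ σ v = trans (cong (_* v) (⟦⟧-* σ τ)) (lem ⟦ σ ⟧ ⟦ τ ⟧ v)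
      where
      lem : ∀ a b v → (a * b) * v ≡ b * (a * v)
      lem = solve-∀

    between : ∀ s {i j k} → i ℤ.≤ j → j ℤ.≤ k → x ℤ.< ⟦ s ⟧ * i → x ℤ.< ⟦ s ⟧ * k → x ℤ.< ⟦ s ⟧ * j
    between Sign.+ i≤j _ x<i _ = ℤᵖ.<-≤-trans x<i (ℤᵖ.*-monoˡ-≤-nonNeg 1ℤ i≤j)
    between Sign.- _ j≤k _ x<k = ℤᵖ.<-≤-trans x<k (ℤᵖ.*-monoˡ-≤-nonPos -1ℤ j≤k)

  -- The hit in the middle row comes from its class and the half-line x < τw. An opposite hit there
  -- would mean class zero and x < -v₂ ≤ -v₁, hence an opposite hit in the first row.
  IsOne-convex : ∀ {v₁ v₂ v₃ c₁ c₂ c₃ σ₁ σ₂ σ₃} →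
    OddRow m v₁ (c₁ , σ₁) → OddRow m v₂ (c₂ , σ₂) → OddRow m v₃ (c₃ , σ₃) → c₂ ≡ b →
    ⟦ σ₁ ⟧ * v₁ ℤ.≤ ⟦ σ₂ ⟧ * v₂ → ⟦ σ₂ ⟧ * v₂ ℤ.≤ ⟦ σ₃ ⟧ * v₃ →
    IsOne v₁ σ₁ → IsOne v₃ σ₃ → IsOne v₂ σ₂
  IsOne-convex {v₁} {v₂} {v₃} {σ₁ = σ₁} {σ₂} {σ₃} row₁ row₂ row₃ c₂≡b w₁≤w₂ w₂≤w₃
    one₁@(hit₁ , miss₁) (hit₃ , _)
    with _ , 2∣x , x<₁ ← hits⇒ m (σ₁ Sign.* τ) (proj₁ row₁) hit₁
       | _ , _ , x<₃ ← hits⇒ m (σ₃ Sign.* τ) (proj₁ row₃) hit₃ = hit₂ , miss₂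
    where
    hit₂ : Hits m v₂ x (σ₂ Sign.* τ)
    hit₂ = ⇒hits m (σ₂ Sign.* τ) (proj₁ row₂) (⇒congruent row₂ c₂≡b) 2∣x
      (subst (x ℤ.<_) (sym (⟦στ⟧ σ₂ v₂))
        (between τ w₁≤w₂ w₂≤w₃ (subst (x ℤ.<_) (⟦στ⟧ σ₁ v₁) x<₁) (subst (x ℤ.<_) (⟦στ⟧ σ₃ v₃) x<₃)))
    c₁≡b = IsOne⇒class row₁ one₁
    miss₂ : ¬ Hits m v₂ x (opposite (σ₂ Sign.* τ))
    miss₂ hit with oppositeHit row₂ hit
    ... | c₂≡0 , b≡0 , refl , refl with proj₂ (proj₁ (proj₂ row₁)) (trans c₁≡b b≡0)
    ...   | refl = miss₁ (⇒hits m Sign.- (proj₁ row₁) (⇒congruent₀ row₁ c₁≡b b≡0 Sign.-) 2∣x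
      (ℤᵖ.<-≤-trans (proj₂ (proj₂ (hits⇒ m Sign.- (proj₁ row₂) hit)))
        (subst₂ ℤ._≤_ (lem v₂) (lem v₁) (ℤᵖ.neg-mono-≤ w₁≤w₂))))
      where
      lem : ∀ v → - (1ℤ * v) ≡ -1ℤ * v
      lem = solve-∀

-- The value is the indicator of `P ε` minus that of `P (opposite ε)`, and the implication rules out
-- -1. With `P` abstract, the filter computes by cases on `P?`.
signedSum-value : ∀ {P : Sign → Set} (P? : ∀ ε → Dec (P ε)) ε → (P (opposite ε) → P ε) →
  let value = ⟦ ε ⟧ * foldr ℤ._+_ 0ℤ (map ⟦_⟧ (filter P? (Sign.+ ∷ Sign.- ∷ []))) in
  ((P ε × ¬ P (opposite ε)) × value ≡ 1ℤ) ⊎ (¬ (P ε × ¬ P (opposite ε)) × value ≡ 0ℤ)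
signedSum-value P? Sign.+ opp with P? Sign.+
... | yes p with P? Sign.-
...   | yes q = inj₂ ((λ (_ , ¬q) → ¬q q) , refl)
...   | no ¬q = inj₁ ((p , ¬q) , refl)
signedSum-value P? Sign.+ opp | no ¬p with P? Sign.-
...   | yes q = contradiction (opp q) ¬p
...   | no _  = inj₂ ((λ (p , _) → ¬p p) , refl)
signedSum-value P? Sign.- opp with P? Sign.+
... | yes q with P? Sign.-
...   | yes _ = inj₂ ((λ (_ , ¬q) → ¬q q) , refl)
...   | no ¬p = contradiction (opp q) ¬p
signedSum-value P? Sign.- opp | no ¬q with P? Sign.-
...   | yes p = inj₁ ((p , ¬q) , refl)
...   | no ¬p = inj₂ ((λ (p , _) → ¬p p) , refl)

-- The folded class and the row pair come from the same `row-∃`, so their classes agree by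
-- definition and only the signs need comparison.
foldingSign-rowSign : ∀ m v → let (c , σ) , _ = rowPair! m v in c ≢ zero → foldingSign m v ≡ σ
foldingSign-rowSign m v c≢0 = decide (+ t m ∣? v - + toℕ c)
  where
  c = proj₁ (proj₁ (rowPair! m v))
  σ = proj₂ (proj₁ (rowPair! m v))
  lem₁ : ∀ v c → v - c ≡ 1ℤ * v - c
  lem₁ = solve-∀
  lem₂ : ∀ v c → 1ℤ * v - c ≡ v - c
  lem₂ = solve-∀
  σ≡- : ∀ s → + t m ∣ ⟦ s ⟧ * v - + toℕ c → ¬ (+ t m ∣ v - + toℕ c) → Sign.- ≡ s
  σ≡- Sign.- _ _ = refl
  σ≡- Sign.+ h ∤ = contradiction (∣-resp (lem₂ v (+ toℕ c)) h) ∤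
  decide : (d : Dec (+ t m ∣ v - + toℕ c)) → (if does d then Sign.+ else Sign.-) ≡ σ
  decide (yes h) = sym (cong proj₂ (proj₂ (proj₂ (rowPair! m v)) {c , Sign.+}
    (∣-resp (lem₁ v (+ toℕ c)) h , λ c≡0 → contradiction c≡0 c≢0)))
  decide (no ∤)  = σ≡- σ (proj₁ (proj₁ (proj₂ (rowPair! m v)))) ∤

frozenEntry-value : ∀ m v (j : Fin m) → let (c , σ) , _ = rowPair! m v; d = m ∸ suc (toℕ j) + 1 in
  (toℕ c ≡ d × ⟦ σ ⟧ * frozenEntry m v j ≡ 1ℤ) ⊎ (toℕ c ≢ d × ⟦ σ ⟧ * frozenEntry m v j ≡ 0ℤ)
frozenEntry-value m v j = decide (toℕ c ℕ.≟ d)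
  where
  c = proj₁ (proj₁ (rowPair! m v))
  σ = proj₂ (proj₁ (rowPair! m v))
  d = m ∸ suc (toℕ j) + 1
  square : ∀ s → ⟦ s ⟧ * ⟦ s ⟧ ≡ 1ℤ
  square Sign.+ = refl
  square Sign.- = refl
  decide : (q : Dec (toℕ c ≡ d)) → let entry = if does q then ⟦ foldingSign m v ⟧ else 0ℤ in
    (toℕ c ≡ d × ⟦ σ ⟧ * entry ≡ 1ℤ) ⊎ (toℕ c ≢ d × ⟦ σ ⟧ * entry ≡ 0ℤ)
  -- The class `d` of a frozen column is a successor, hence nonzero, as `foldingSign-rowSign`
  -- requires.
  decide (yes c≡d) = inj₁ (c≡d , trans (cong (λ s → ⟦ σ ⟧ * ⟦ s ⟧)
    (foldingSign-rowSign m v λ c≡0 → ℕᵖ.0≢1+n (trans (sym (cong toℕ c≡0)) (trans c≡d (ℕᵖ.+-comm _ 1)))))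
    (square σ))
  decide (no c≢d)  = inj₂ (c≢d , ℤᵖ.*-zeroʳ ⟦ σ ⟧)

V-odd : ∀ {R} (Λ : Fin R → ℕ) i → Odd (V Λ i)
V-odd {R} Λ i 2∣V with () ← ℕᵈ.∣1⇒≡1 (ℕᵈ.∣m+n∣m⇒∣n (∣⇒∣ᵤ 2∣V)
  (ℕᵈ.∣m∣n⇒∣m+n (ℕᵈ.m∣m*n (Λ i)) (ℕᵈ.m∣m*n (R ∸ suc (toℕ i)))))

V-positive : ∀ {R} (Λ : Fin R → ℕ) i → 0ℤ ℤ.< V Λ i
V-positive Λ i = +<+ (ℕᵖ.m≤n+m 1 _)

-- The lexicographic order of the rows

module _ {R : ℕ} (m : ℕ) (Λ : Fin R → ℕ) where

  oddRow : ∀ i → OddRow m (V Λ i) (rowClass m Λ i , rowSign m Λ i)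
  oddRow i = V-odd Λ i , proj₂ (rowPair! m (V Λ i))

  Precedes : Fin R → Fin R → Set
  Precedes i i′ = ×-Lex _≡_ Fin._<_ ℤ._<_ (rowClass m Λ i , w m Λ i) (rowClass m Λ i′ , w m Λ i′)

  -- Ties are broken by the index of the row, so that the order is visibly total.
  orderingPermutation : ∃[ π ] OrdersRows m Λ π
  orderingPermutation =
    let π , mono = sortingPermutation {_≺_ = λ i i′ → key i O.< key i′} O.trans
          (λ { refl → O.irrefl O.Eq.refl }) compare
    in π , λ i i′ → mono i i′ ∘ inj₁
    where
    module O = StrictTotalOrder (×-strictTotalOrder
      (×-strictTotalOrder (Finᵖ.<-strictTotalOrder (suc m)) ℤᵖ.<-strictTotalOrder)
      (Finᵖ.<-strictTotalOrder R))
    key : Fin R → O.Carrier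
    key i = (rowClass m Λ i , w m Λ i) , i
    compare : ∀ i i′ → Tri (key i O.< key i′) (i ≡ i′) (key i′ O.< key i)
    compare i i′ with O.compare (key i) (key i′)
    ... | tri< a b c = tri< a (λ { refl → b O.Eq.refl }) c
    ... | tri≈ a b c = tri≈ a (proj₂ b) c
    ... | tri> a b c = tri> a (λ { refl → b O.Eq.refl }) c

  ¬precedes⇒class≤ : ∀ {i i′} → ¬ Precedes i′ i → rowClass m Λ i Fin.≤ rowClass m Λ i′
  ¬precedes⇒class≤ ⊀ = ℕᵖ.≮⇒≥ (⊀ ∘ inj₁)

  ¬precedes⇒w≤ : ∀ {i i′} → ¬ Precedes i′ i → rowClass m Λ i ≡ rowClass m Λ i′ → w m Λ i ℤ.≤ w m Λ i′
  ¬precedes⇒w≤ ⊀ eq = ℤᵖ.≮⇒≥ λ w< → ⊀ (inj₂ (sym eq , w<))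

-- Interval property of the columns and total unimodularity

module _ (m : ℕ) {r : ℕ} (Λ : Fin (m + r) → ℕ) (X : Fin r → ℤ) where

  module Free (k : Fin r) = FreeEntry m {X k} (proj₁ (proj₂ (columnPair! m (X k))))

  slotSign : Fin m ⊎ Fin r → Sign
  slotSign = [ (λ _ → Sign.+) , (λ k → proj₂ (proj₁ (columnPair! m (X k)))) ]′

  slotEntry : Fin (m + r) → Fin m ⊎ Fin r → ℤ
  slotEntry i = [ frozenEntry m (V Λ i) , (λ k → freeEntry m (V Λ i) (X k)) ]′

  One : Fin (m + r) → Fin m ⊎ Fin r → Set
  One i (inj₁ j) = toℕ (rowClass m Λ i) ≡ m ∸ suc (toℕ j) + 1
  One i (inj₂ k) = Free.IsOne k (V Λ i) (rowSign m Λ i)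

  entry-value : ∀ i s → let value = ⟦ rowSign m Λ i ⟧ * ⟦ slotSign s ⟧ * slotEntry i s in
    (One i s × value ≡ 1ℤ) ⊎ (¬ One i s × value ≡ 0ℤ)
  entry-value i (inj₁ j) = subst
    (λ y → (One i (inj₁ j) × y * frozenEntry m (V Λ i) j ≡ 1ℤ) ⊎
           (¬ One i (inj₁ j) × y * frozenEntry m (V Λ i) j ≡ 0ℤ))
    (sym (ℤᵖ.*-identityʳ ⟦ rowSign m Λ i ⟧)) (frozenEntry-value m (V Λ i) j)
  entry-value i (inj₂ k) = subst
    (λ y → (One i (inj₂ k) × y * freeEntry m (V Λ i) (X k) ≡ 1ℤ) ⊎
           (¬ One i (inj₂ k) × y * freeEntry m (V Λ i) (X k) ≡ 0ℤ))
    (⟦⟧-* σ τ)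
    (signedSum-value (hits? m (V Λ i) (X k)) (σ Sign.* τ)
      (Free.oppositeHit⇒hit k (oddRow m Λ i) (V-positive Λ i)))
    where
    σ = rowSign m Λ i
    τ = slotSign (inj₂ k)

  -- A frozen column marks an entire class, and classes increase along the order. In a free column
  -- both ends have class `b`, hence so does the middle row, and within one class the rows are
  -- ordered by `w`.
  One-convex : ∀ s i₁ i₂ i₃ → ¬ Precedes m Λ i₂ i₁ → ¬ Precedes m Λ i₃ i₂ →
    One i₁ s → One i₃ s → One i₂ s
  One-convex (inj₁ j) i₁ i₂ i₃ p q one₁ one₃ = ℕᵖ.≤-antisym
    (subst (toℕ (rowClass m Λ i₂) ≤_) one₃ (¬precedes⇒class≤ m Λ {i₂} {i₃} q))
    (subst (_≤ toℕ (rowClass m Λ i₂)) one₁ (¬precedes⇒class≤ m Λ {i₁} {i₂} p))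
  One-convex (inj₂ k) i₁ i₂ i₃ p q one₁ one₃ =
    Free.IsOne-convex k (oddRow m Λ i₁) (oddRow m Λ i₂) (oddRow m Λ i₃) c₂≡b
      (¬precedes⇒w≤ m Λ {i₁} {i₂} p (trans c₁≡b (sym c₂≡b)))
      (¬precedes⇒w≤ m Λ {i₂} {i₃} q (trans c₂≡b (sym c₃≡b))) one₁ one₃
    where
    c₁≡b = Free.IsOne⇒class k (oddRow m Λ i₁) one₁
    c₃≡b = Free.IsOne⇒class k (oddRow m Λ i₃) one₃
    c₂≡b = Finᵖ.≤-antisym
      (subst (rowClass m Λ i₂ Fin.≤_) c₃≡b (¬precedes⇒class≤ m Λ {i₂} {i₃} q))
      (subst (Fin._≤ rowClass m Λ i₂) c₁≡b (¬precedes⇒class≤ m Λ {i₁} {i₂} p))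

  M̂-zeroOne : ∀ π → ZeroOne (M̂ m Λ X π)
  M̂-zeroOne π p j = Sum.swap (Sum.map proj₂ proj₂ (entry-value (π ⟨$⟩ˡ p) (splitAt m j)))

  value≡1⇒One : ∀ i s → ⟦ rowSign m Λ i ⟧ * ⟦ slotSign s ⟧ * slotEntry i s ≡ 1ℤ → One i s
  value≡1⇒One i s eq =
    [ proj₁ , (λ (_ , eq₀) → contradiction (trans (sym eq) eq₀) λ ()) ]′ (entry-value i s)

  One⇒value≡1 : ∀ i s → One i s → ⟦ rowSign m Λ i ⟧ * ⟦ slotSign s ⟧ * slotEntry i s ≡ 1ℤ
  One⇒value≡1 i s one = [ proj₂ , (λ (¬one , _) → contradiction one ¬one) ]′ (entry-value i s)

  M̂-consecutiveOnes : ∀ π → OrdersRows m Λ π → ConsecutiveOnes (M̂ m Λ X π)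
  M̂-consecutiveOnes π ordered j p₁ p₂ p₃ p₁≤p₂ p₂≤p₃ one₁ one₃ =
    One⇒value≡1 (π ⟨$⟩ˡ p₂) s (One-convex s _ _ _ (after p₁≤p₂) (after p₂≤p₃)
      (value≡1⇒One (π ⟨$⟩ˡ p₁) s one₁) (value≡1⇒One (π ⟨$⟩ˡ p₃) s one₃))
    where
    s = splitAt m j
    -- `OrdersRows` constrains only strict precedence and leaves ties open, so a weak inequality of
    -- positions yields a negation.
    after : ∀ {p q} → p Fin.≤ q → ¬ Precedes m Λ (π ⟨$⟩ˡ q) (π ⟨$⟩ˡ p)
    after {p} {q} p≤q ≺ = ℕᵖ.<⇒≱ (subst₂ Fin._<_ (inverseʳ π) (inverseʳ π) (ordered _ _ ≺)) p≤q

  -- Rows stay in the order given by `f`, while `ρ` records their places under `π`. Putting the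
  -- signs back on the ones of `M̂` recovers the submatrix of `M`, since signs square to one.
  M-totallyUnimodular : TotallyUnimodular (M m Λ X)
  M-totallyUnimodular k f g f-increasing g-increasing =
    subst SignOrZero (det-cong signed≗M)
      (det-signed-convex ρ ρ-injective (rowSign m Λ ∘ f) (columnSign m X ∘ g) N
        (⊂-wellFounded (support N)) N-convex)
    where
    π = proj₁ (orderingPermutation m Λ)
    ρ : Fin k → Fin (m + r)
    ρ i = π ⟨$⟩ʳ f i
    f-injective : ∀ {i i′} → f i ≡ f i′ → i ≡ i′
    f-injective {i} {i′} eq with Finᵖ.<-cmp i i′
    ... | tri< i<i′ _ _ = contradiction (f-increasing i<i′) (ℕᵖ.<-irrefl (cong toℕ eq))
    ... | tri≈ _ i≡i′ _ = i≡i′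
    ... | tri> _ _ i′<i = contradiction (f-increasing i′<i) (ℕᵖ.<-irrefl (cong toℕ (sym eq)))
    ρ-injective : ∀ {i i′} → ρ i ≡ ρ i′ → i ≡ i′
    ρ-injective eq = f-injective (trans (sym (inverseˡ π)) (trans (cong (π ⟨$⟩ˡ_) eq) (inverseˡ π)))
    N : Incidence k
    N i j = does (M̂ m Λ X π (ρ i) (g j) ℤᵖ.≟ 1ℤ)
    N⇒1 : ∀ i j → N i j ≡ true → M̂ m Λ X π (ρ i) (g j) ≡ 1ℤ
    N⇒1 i j = does⇒proof (M̂ m Λ X π (ρ i) (g j) ℤᵖ.≟ 1ℤ)
    N-convex : Convex ρ N
    N-convex j a b c a≤b b≤c p q = dec-true (_ ℤᵖ.≟ 1ℤ)
      (M̂-consecutiveOnes π (proj₂ (orderingPermutation m Λ)) (g j) (ρ a) (ρ b) (ρ c) a≤b b≤c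
        (N⇒1 a j p) (N⇒1 c j q))
    bit-zeroOne : ∀ z → z ≡ 0ℤ ⊎ z ≡ 1ℤ → bit (does (z ℤᵖ.≟ 1ℤ)) ≡ z
    bit-zeroOne z (inj₁ refl) = refl
    bit-zeroOne z (inj₂ refl) = refl
    unsign : ∀ s s′ x → ⟦ s ⟧ * ⟦ s′ ⟧ * (⟦ s ⟧ * ⟦ s′ ⟧ * x) ≡ x
    unsign Sign.+ Sign.+ = solve-∀
    unsign Sign.+ Sign.- = solve-∀
    unsign Sign.- Sign.+ = solve-∀
    unsign Sign.- Sign.- = solve-∀
    signed≗M : ∀ i j → signed (rowSign m Λ ∘ f) (columnSign m X ∘ g) N i j ≡ M m Λ X (f i) (g j)
    signed≗M i j = trans
      (cong (⟦ rowSign m Λ (f i) ⟧ * ⟦ columnSign m X (g j) ⟧ *_)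
        (trans (bit-zeroOne _ (M̂-zeroOne π (ρ i) (g j)))
          (cong (λ i → ⟦ rowSign m Λ i ⟧ * ⟦ columnSign m X (g j) ⟧ * M m Λ X i (g j)) (inverseˡ π))))
      (unsign (rowSign m Λ (f i)) (columnSign m X (g j)) _)

lemma5p25 : (m r : ℕ) → 3 ≤ t m → 2 ≤ r →
    (Λ : Fin (m + r) → ℕ) → (∀ i j → i Fin.≤ j → Λ j ≤ Λ i) →
    (X : Fin r → ℤ) →
    (∃[ π ] OrdersRows m Λ π) ×
    (∀ π → OrdersRows m Λ π →
    ZeroOne (M̂ m Λ X π) × ConsecutiveOnes (M̂ m Λ X π)) ×
    TotallyUnimodular (M m Λ X)
lemma5p25 m r _ _ Λ _ X =
    orderingPermutation m Λ
  , (λ π ordered → M̂-zeroOne m Λ X π , M̂-consecutiveOnes m Λ X π ordered)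
  , M-totallyUnimodular m Λ X
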